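{- Let $n_1,n_2\ge 2$, let $S_{n_1,n_2}$ be the double star on $n_1+n_2$ vertices, and let $k\ge3$. Then the spectrum of the Seidel matrix of the uniform double hyperstar $S_{n_1,n_2}^k$ is $$\sigma_S(S_{n_1,n_2}^k)=\begin{pmatrix}1 & -2k+3 & r_1 & r_2 & r_3 & r_4 & r_5\\ (k-2)(n_1+n_2-1)-1 & n_1+n_2-4 & 1&1&1&1&1\end{pmatrix},$$ where $r_1,\dots,r_5$ are the eigenvalues (with multiplicity) of the quotient matrix $$Q=\begin{bmatrix} 0 & -(n_1-1)(k-1) & -1 & (n_2-1)(k-1) & 2-k\\ -1 & (n_1-3)(k-1)+1 & 1 & (n_2-1)(k-1) & k-2\\ -1 & (n_1-1)(k-1) & 0 & -(n_2-1)(k-1) & 2-k\\ 1 & (n_1-1)(k-1) & -1 & (n_2-3)(k-1)+1 & k-2\\ -1 & (n_1-1)(k-1) & -1 & (n_2-1)(k-1) & 3-k \end{bmatrix}.$$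
   Context: A hypergraph $G^*=(V,E)$ has a finite vertex set $V=\{v_1,\dots,v_N\}$ and a finite set $E$ of hyperedges, each a subset of $V$. Its adjacency matrix $A=(a_{ij})$ has $a_{ij}=|\{e\in E:\{v_i,v_j\}\subset e\}|$ for $i\ne j$ and $a_{ii}=0$. Its Seidel matrix is $S=J_N-I_N-2A$ ($J_N$ all-ones matrix, $I_N$ identity). A star $S_n$ is the tree on $n$ vertices with one central vertex joined to the $n-1$ other vertices. The double star $S_{n_1,n_2}$ is the graph obtained from disjoint stars $S_{n_1}$ and $S_{n_2}$ by adding an edge joining their central vertices. The uniform double hyperstar $S_{n_1,n_2}^k$ is the $k$-th power of $S_{n_1,n_2}$: the $k$-uniform hypergraph obtained by adding to each edge of $S_{n_1,n_2}$ its own $k-2$ new vertices (pairwise disjoint sets for different edges). $Q$ is the quotient matrix (matrix of block row sums) of the Seidel matrix for the equitable partition of the vertices into: the centre of $S_{n_1}$; the $(n_1-1)(k-1)$ degree-one vertices of hyperedges coming from $S_{n_1}$; the centre of $S_{n_2}$; the $(n_2-1)(k-1)$ degree-one vertices of hyperedges coming from $S_{n_2}$; the $k-2$ vertices added to the edge joining the two centres. The two-row notation for a spectrum lists eigenvalues in the first row and multiplicities in the second; it is read as a multiset (if listed values coincide, their multiplicities add, and multiplicity $0$ means the entry is absent). -}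

module Defs where

open import Algebra.Apartness.Bundles using (HeytingField; HeytingCommutativeRing)
open import Algebra.Bundles using (CommutativeRing; Semiring)
open import Data.Bool.Base using (if_then_else_)
open import Data.Fin.Base using (Fin; zero; suc; toℕ; splitAt; quotient; punchIn)
open import Data.Fin.Patterns using (0F; 1F; 2F; 3F; 4F)
open import Data.Fin.Properties using (_≟_; +↔⊎)
open import Data.Fin.Subset using (Subset; inside; outside; _∈_; ⊥; ⁅_⁆; ∣_∣)
open import Data.Fin.Subset.Properties using (_∈?_; ∣⊥∣≡0; ∣⁅x⁆∣≡1; x∈⁅x⁆; x∈⁅y⁆⇒x≡y)
open import Data.Integer.Base using (ℤ; +_; -[1+_])
open import Data.Integer.Properties using (+-0-monoid)
open import Data.List.Base using (List; foldr)
open import Data.Nat.Base as ℕ using (ℕ; zero; suc; _∸_; NonZero)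
open import Data.Nat.Properties using (+-identityʳ)
open import Data.Product.Base using (_×_; _,_)
open import Data.Sum.Base using (_⊎_; inj₁; inj₂; [_,_]′)
open import Data.Vec.Base using ([]; _∷_; _++_; concat; lookup; map; replicate; tabulate)
open import Data.Vec.Properties using (++-injectiveˡ; ++-injectiveʳ; ∷-injectiveʳ)
open import Function.Base using (_∘_)
open import Function.Bundles using (Injection)
open import Function.Definitions using (Injective)
open import Function.Properties.Inverse using (↔⇒↣)
open import Level using (Level; _⊔_)
open import Relation.Binary.PropositionalEquality.Core using (_≡_; _≢_; refl; sym; trans; cong; cong₂; subst; subst₂)
open import Relation.Nullary.Decidable using (does; _×-dec_)
open import Relation.Nullary.Negation using (contradiction)

import Algebra.Definitions.RawSemiring as RawSemiring
import Algebra.Properties.Monoid.Sum as Sum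

private
  variable
    c ℓ₁ ℓ₂ : Level
    m n : ℕ

Matrix : Set c → ℕ → Set c
Matrix A n = Fin n → Fin n → A

-- The edge set is given as an injectively indexed family of vertex subsets.
record Hypergraph : Set where
  field
    order          : ℕ
    size           : ℕ
    edge           : Fin size → Subset order
    edge-injective : Injective _≡_ _≡_ edge

  Vertex : Set
  Vertex = Fin order

Uniform : ℕ → Hypergraph → Set
Uniform k G = ∀ e → ∣ edge e ∣ ≡ k
  where open Hypergraph G

module _ (G : Hypergraph) where
  open Hypergraph G

  adjacency : Matrix ℕ order
  adjacency i j =
    if does (i ≟ j)
    then 0
    else ∣ tabulate (λ e → does ((i ∈? edge e) ×-dec (j ∈? edge e))) ∣

  seidel : Matrix ℤ order
  seidel i j = + 1 - (if does (i ≟ j) then + 1 else + 0) - + 2 * + adjacency i j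
    where open import Data.Integer.Base using (_-_; _*_)

record Graph : Set where
  field
    hypergraph : Hypergraph
    2-uniform  : Uniform 2 hypergraph

  open Hypergraph hypergraph public

-- The vertices of the k-th power are those of G, followed by a block of k ∸ 2
-- new vertices for each edge of G (concat repeats each bit of ⁅ e ⁆ k ∸ 2 times).
power : ℕ → Graph → Hypergraph
power k G = record
  { order          = order ℕ.+ size ℕ.* (k ∸ 2)
  ; size           = size
  ; edge           = λ e → edge e ++ concat (map (replicate (k ∸ 2)) ⁅ e ⁆)
  ; edge-injective = edge-injective ∘ ++-injectiveˡ _ _
  }
  where open Graph G

⁅⁆-injective : Injective _≡_ _≡_ (⁅_⁆ {n})
⁅⁆-injective {x = x} {y} eq = x∈⁅y⁆⇒x≡y y (subst (x ∈_) eq (x∈⁅x⁆ x))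

∣p++q∣≡∣p∣+∣q∣ : (p : Subset m) (q : Subset n) → ∣ p ++ q ∣ ≡ ∣ p ∣ ℕ.+ ∣ q ∣
∣p++q∣≡∣p∣+∣q∣ []            q = refl
∣p++q∣≡∣p∣+∣q∣ (inside  ∷ p) q = cong suc (∣p++q∣≡∣p∣+∣q∣ p q)
∣p++q∣≡∣p∣+∣q∣ (outside ∷ p) q = ∣p++q∣≡∣p∣+∣q∣ p q

-- Vertex zero is the centre.
star : (n : ℕ) .{{_ : NonZero n}} → Graph
star (suc m) = record
  { hypergraph = record
    { order          = suc m
    ; size           = m
    ; edge           = λ i → inside ∷ ⁅ i ⁆
    ; edge-injective = ⁅⁆-injective ∘ ∷-injectiveʳ
    }
  ; 2-uniform = λ i → cong suc (∣⁅x⁆∣≡1 i)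
  }

-- The disjoint union of G and H with one further edge, joining u to v, which
-- is listed first.
module Bridge (G H : Graph) (u : Graph.Vertex G) (v : Graph.Vertex H) where
  private
    module G = Graph G
    module H = Graph H

  oldEdge : Fin G.size ⊎ Fin H.size → Subset (G.order ℕ.+ H.order)
  oldEdge (inj₁ e) = G.edge e ++ ⊥
  oldEdge (inj₂ e) = ⊥ ++ H.edge e

  edge : Fin (suc (G.size ℕ.+ H.size)) → Subset (G.order ℕ.+ H.order)
  edge zero    = ⁅ u ⁆ ++ ⁅ v ⁆
  edge (suc i) = oldEdge (splitAt G.size i)

  private
    ∣∣≢⇒≢ : {p q : Subset n} → ∣ p ∣ ≢ ∣ q ∣ → p ≢ q
    ∣∣≢⇒≢ ∣p∣≢∣q∣ refl = ∣p∣≢∣q∣ refl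

    2-subset≢⊥ : {p : Subset n} → ∣ p ∣ ≡ 2 → p ≢ ⊥
    2-subset≢⊥ {n} ∣p∣≡2 = ∣∣≢⇒≢ (subst₂ _≢_ (sym ∣p∣≡2) (sym (∣⊥∣≡0 n)) λ ())

    2-subset≢⁅x⁆ : {p : Subset n} (x : Fin n) → ∣ p ∣ ≡ 2 → p ≢ ⁅ x ⁆
    2-subset≢⁅x⁆ x ∣p∣≡2 = ∣∣≢⇒≢ (subst₂ _≢_ (sym ∣p∣≡2) (sym (∣⁅x⁆∣≡1 x)) λ ())

    oldEdge-injective : Injective _≡_ _≡_ oldEdge
    oldEdge-injective {inj₁ e} {inj₁ f} eq =
      cong inj₁ (G.edge-injective (++-injectiveˡ _ _ eq))
    oldEdge-injective {inj₁ e} {inj₂ f} eq =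
      contradiction (++-injectiveˡ (G.edge e) ⊥ eq) (2-subset≢⊥ (G.2-uniform e))
    oldEdge-injective {inj₂ e} {inj₁ f} eq =
      contradiction (++-injectiveˡ (G.edge f) ⊥ (sym eq)) (2-subset≢⊥ (G.2-uniform f))
    oldEdge-injective {inj₂ e} {inj₂ f} eq =
      cong inj₂ (H.edge-injective (++-injectiveʳ {n = G.order} ⊥ ⊥ eq))

    oldEdge≢bridge : ∀ s → oldEdge s ≢ ⁅ u ⁆ ++ ⁅ v ⁆
    oldEdge≢bridge (inj₁ e) eq = 2-subset≢⁅x⁆ u (G.2-uniform e) (++-injectiveˡ (G.edge e) ⁅ u ⁆ eq)
    oldEdge≢bridge (inj₂ e) eq = 2-subset≢⁅x⁆ v (H.2-uniform e) (++-injectiveʳ ⊥ ⁅ u ⁆ eq)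

    edge-injective : Injective _≡_ _≡_ edge
    edge-injective {zero}  {zero}  _  = refl
    edge-injective {zero}  {suc j} eq = contradiction (sym eq) (oldEdge≢bridge (splitAt G.size j))
    edge-injective {suc i} {zero}  eq = contradiction eq (oldEdge≢bridge (splitAt G.size i))
    edge-injective {suc i} {suc j} eq =
      cong suc (Injection.injective (↔⇒↣ (+↔⊎ {m = G.size}))
        (oldEdge-injective {splitAt G.size i} {splitAt G.size j} eq))

    ∣oldEdge∣≡2 : ∀ s → ∣ oldEdge s ∣ ≡ 2
    ∣oldEdge∣≡2 (inj₁ e) = trans (∣p++q∣≡∣p∣+∣q∣ (G.edge e) ⊥)
      (trans (cong₂ ℕ._+_ (G.2-uniform e) (∣⊥∣≡0 H.order)) (+-identityʳ 2))
    ∣oldEdge∣≡2 (inj₂ e) = trans (∣p++q∣≡∣p∣+∣q∣ {m = G.order} ⊥ (H.edge e))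
      (cong₂ ℕ._+_ (∣⊥∣≡0 G.order) (H.2-uniform e))

    2-uniform : ∀ e → ∣ edge e ∣ ≡ 2
    2-uniform zero    = trans (∣p++q∣≡∣p∣+∣q∣ ⁅ u ⁆ ⁅ v ⁆)
      (cong₂ ℕ._+_ (∣⁅x⁆∣≡1 u) (∣⁅x⁆∣≡1 v))
    2-uniform (suc i) = ∣oldEdge∣≡2 (splitAt G.size i)

  bridge : Graph
  bridge = record
    { hypergraph = record
      { order          = G.order ℕ.+ H.order
      ; size           = suc (G.size ℕ.+ H.size)
      ; edge           = edge
      ; edge-injective = edge-injective
      }
    ; 2-uniform = 2-uniform
    }

open Bridge public using (bridge)

doubleStar : (n₁ n₂ : ℕ) .{{_ : NonZero n₁}} .{{_ : NonZero n₂}} → Graph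
doubleStar n₁@(suc _) n₂@(suc _) = bridge (star n₁) (star n₂) zero zero

doubleHyperstar : (n₁ n₂ k : ℕ) .{{_ : NonZero n₁}} .{{_ : NonZero n₂}} → Hypergraph
doubleHyperstar n₁ n₂ k = power k (doubleStar n₁ n₂)

-- The classes, in order: the centre of the first star; the degree-one vertices
-- of the hyperedges from the first star (its leaves and the new vertices of its
-- edges); the same two classes for the second star; the new vertices of the
-- hyperedge through both centres.
block : (n₁ n₂ k : ℕ) .{{_ : NonZero n₁}} .{{_ : NonZero n₂}} →
        Hypergraph.Vertex (doubleHyperstar n₁ n₂ k) → Fin 5
block n₁@(suc m₁) n₂@(suc m₂) k =
  [ [ starBlock 0F 1F , starBlock 2F 3F ]′ ∘ splitAt n₁
  , edgeBlock ∘ quotient (k ∸ 2)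
  ]′ ∘ splitAt (n₁ ℕ.+ n₂)
  where
  starBlock : Fin 5 → Fin 5 → Fin (suc n) → Fin 5
  starBlock centre leaf zero    = centre
  starBlock centre leaf (suc _) = leaf

  edgeBlock : Fin (suc (m₁ ℕ.+ m₂)) → Fin 5
  edgeBlock zero    = 4F
  edgeBlock (suc e) = [ (λ _ → 1F) , (λ _ → 3F) ]′ (splitAt m₁ e)

-- The partition of the indices into the fibres of π is equitable for M, and Q
-- is the matrix of its block row sums.
IsQuotientMatrix : Matrix ℤ n → (Fin n → Fin m) → Matrix ℤ m → Set
IsQuotientMatrix M π Q =
  ∀ i b → sum (λ j → if does (π j ≟ b) then M i j else + 0) ≡ Q (π i) b
  where open Sum +-0-monoid using (sum)

quotientMatrix : (n₁ n₂ k : ℕ) → Matrix ℤ 5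
quotientMatrix n₁ n₂ k i j = lookup (lookup rows i) j
  where
  open import Data.Integer.Base using (_+_; _-_; _*_; -_)
  a b κ : ℤ
  a = + n₁
  b = + n₂
  κ = + k
  rows =
      ( + 0   ∷ - ((a - + 1) * (κ - + 1))       ∷ - + 1 ∷ (b - + 1) * (κ - + 1)         ∷ + 2 - κ ∷ [] )
    ∷ ( - + 1 ∷ (a - + 3) * (κ - + 1) + + 1     ∷ + 1   ∷ (b - + 1) * (κ - + 1)         ∷ κ - + 2 ∷ [] )
    ∷ ( - + 1 ∷ (a - + 1) * (κ - + 1)           ∷ + 0   ∷ - ((b - + 1) * (κ - + 1))     ∷ + 2 - κ ∷ [] )
    ∷ ( + 1   ∷ (a - + 1) * (κ - + 1)           ∷ - + 1 ∷ (b - + 3) * (κ - + 1) + + 1   ∷ κ - + 2 ∷ [] )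
    ∷ ( - + 1 ∷ (a - + 1) * (κ - + 1)           ∷ - + 1 ∷ (b - + 1) * (κ - + 1)         ∷ + 3 - κ ∷ [] )
    ∷ []

-- The field in which eigenvalues are taken: any (constructive) field, with the
-- reals and the complex numbers among its instances.
module Spectral (K : HeytingField c ℓ₁ ℓ₂) where
  open HeytingField K hiding (zero)
  private
    commutativeRing = HeytingCommutativeRing.commutativeRing heytingCommutativeRing
    module K = RawSemiring (Semiring.rawSemiring (CommutativeRing.semiring commutativeRing))
  open K using (sum; _^_)

  CharacteristicZero : Set ℓ₂
  CharacteristicZero = ∀ n → (suc n K.× 1#) # 0#

  fromℤ : ℤ → Carrier
  fromℤ (+ n)    = n K.× 1#
  fromℤ -[1+ n ] = - (suc n K.× 1#)

  -- Laplace expansion along the first row.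
  det : Matrix Carrier n → Carrier
  det {zero}  M = 1#
  det {suc n} M = sum λ j → (- 1#) ^ toℕ j * M zero j * det λ r s → M (suc r) (punchIn j s)

  -- The characteristic polynomial det (x I - M), as a polynomial function.
  charPoly : Matrix ℤ n → Carrier → Carrier
  charPoly M x = det λ i j → (if does (i ≟ j) then x else 0#) - fromℤ (M i j)

  -- A list of (value , multiplicity) pairs is the spectrum of M, with algebraic
  -- multiplicities and entries with equal values read additively, when the
  -- characteristic polynomial is the product of the (x - value) ^ multiplicity.
  -- A field of characteristic zero is infinite, so there the equality of
  -- polynomial functions is the equality of polynomials.
  IsSpectrum : Matrix ℤ n → List (Carrier × ℕ) → Set (c ⊔ ℓ₁)
  IsSpectrum M σ = ∀ x → charPoly M x ≈ foldr (λ (λᵢ , mᵢ) p → (x - λᵢ) ^ mᵢ * p) 1# σ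

-- Every entry of the Seidel matrix S, apart from a shift by 1 on the diagonal,
-- depends only on the hyperedges (or the centres) in which its two vertices lie.
-- If rows 0 and 1 of x I - M differ by d (e₀ - e₁), subtracting one from the other
-- and expanding gives det (x I - M) = d det (x I - M′), where M′ lacks index 0
-- and has the sum of columns 0 and 1 as its column for the index that remains.
-- Merging the degree-one vertices of each hyperedge splits off powers of x - 1.
-- The resulting matrix is again constant on classes up to a diagonal shift, which
-- now is 3 - 2k on the two classes of degree-one vertices; merging the hyperedges
-- of each star splits off powers of x - (3 - 2k) and leaves Q.

module Submission where

open import Defs
open import Algebra.Apartness.Bundles using (HeytingField; HeytingCommutativeRing)
open import Algebra.Bundles using (CommutativeRing)
import Algebra.Properties.AbelianGroup as AbelianGroupProperties
import Algebra.Properties.CommutativeMonoid.Sum as CommutativeMonoidSum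
import Algebra.Properties.CommutativeSemigroup as CommutativeSemigroupProperties
import Algebra.Properties.Ring as RingProperties
import Algebra.Properties.Semiring.Exp as SemiringExp
import Algebra.Properties.Semiring.Mult as SemiringMult
import Algebra.Properties.Semiring.Sum as SemiringSum
open import Data.Bool.Base using (Bool; true; false; if_then_else_; _∧_)
open import Data.Bool.Properties using (∧-comm)
open import Data.Fin.Base using
  (Fin; zero; suc; toℕ; punchIn; cast; splitAt; quotient; remainder; combine; join; _↑ˡ_; _↑ʳ_)
open import Data.Fin.Patterns using (0F; 1F; 2F; 3F; 4F)
open import Data.Fin.Properties using
  ( _≟_; all?; cast-is-id; combine-remQuot; join-splitAt; splitAt-↑ˡ; splitAt-↑ʳ
  ; splitAt⁻¹-↑ˡ; splitAt⁻¹-↑ʳ; ↑ˡ-injective; ↑ʳ-injective )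
open import Data.Fin.Subset using (Subset; inside; ⁅_⁆; ∣_∣) renaming (⊥ to ∅)
open import Data.Fin.Subset.Properties using (_∈?_)
open import Data.Integer.Base as ℤ using (ℤ; +_; -[1+_])
import Data.Integer.Properties as ℤₚ
open import Data.Integer.Tactic.RingSolver using (solve-∀)
open import Data.List.Base as List using
  (List; _∷_; []; _++_; length; replicate; concatMap; tabulate; allFin)
import Data.List.Properties as List
open import Data.List.Relation.Binary.Permutation.Propositional as Perm using (_↭_; ↭-reflexive; ↭-sym; prep; swap)
import Data.List.Relation.Binary.Permutation.Propositional.Properties as Perm
open import Data.Nat.Base as ℕ using (ℕ; zero; suc; _≤_; _∸_; NonZero; z≤n; s≤s)
open import Data.Nat.ListAction using () renaming (sum to sumℕ)
import Data.Nat.Properties as ℕ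
open import Data.Product.Base using (_×_; _,_; proj₁; proj₂)
open import Data.Sum.Base using (_⊎_; inj₁; inj₂; [_,_]′)
open import Data.Sum.Properties using ([,]-map; [,]-∘)
open import Data.Vec.Base as Vec using ([]; _∷_)
import Data.Vec.Properties as Vec
open import Function.Base using (_∘_; const)
open import Function.Bundles using (mk⇔)
open import Level using (Level)
import Relation.Binary.Reasoning.Setoid as SetoidReasoning
open import Relation.Binary.PropositionalEquality as ≡ using (_≡_; _≢_; _≗_; module ≡-Reasoning)
open import Relation.Nullary.Decidable using (does; yes; no; does-⇔; from-yes; dec-true; dec-false)
open import Relation.Nullary.Negation using (contradiction)

-- Merging adds columns but not rows, so symmetry of the matrix is lost at once. A family closed
-- under merging is given by points that carry a label and a weight: the weight multiplies a column,
-- the label fixes everything else. Up to a simultaneous permutation of rows and columns such a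
-- matrix depends only on the list of its points, so the linear algebra is confined to one merge at
-- the head of a list, and the rest is rearrangement of lists. Sums over blocks are additive in the
-- weights and survive the same reductions, which therefore yield both the quotient matrix and the
-- characteristic polynomial. Two rounds of merging are needed because degree-one vertices of one
-- star have the entry -1 inside a common hyperedge and 1 otherwise: before the first round, rows of
-- the same class differ off the diagonal too.

private
  variable
    c ℓ₁ ℓ₂ : Level
    m n : ℕ
    A B : Set

-- Determinants

-- The transposition of the positions `m` and `m + 1`. Adjacent transpositions suffice, since `_↭_`
-- is generated by swaps of neighbours behind a prefix.
adjacentSwap : ∀ m → Fin (m ℕ.+ suc (suc n)) → Fin (m ℕ.+ suc (suc n))
adjacentSwap zero    zero          = 1F
adjacentSwap zero    (suc zero)    = 0F
adjacentSwap zero    (suc (suc i)) = suc (suc i)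
adjacentSwap (suc m) zero          = zero
adjacentSwap (suc m) (suc i)       = suc (adjacentSwap m i)

module Determinant (K : HeytingField c ℓ₁ ℓ₂) where
  open Spectral K using (det)
  private
    commutativeRing = HeytingCommutativeRing.commutativeRing (HeytingField.heytingCommutativeRing K)
  open CommutativeRing commutativeRing
  open CommutativeMonoidSum +-commutativeMonoid using (sum; sum-cong-≋; ∑-distrib-+; ∑-comm; sum-replicate-zero)
  open SemiringSum semiring using (*-distribˡ-sum)
  open SemiringExp semiring using (_^_)
  open RingProperties ring
    using (-1*x≈-x; -‿+-comm; -‿involutive; -‿distribˡ-*; -‿distribʳ-*; -0#≈0#)
  open CommutativeSemigroupProperties *-commutativeSemigroup using (x∙yz≈y∙xz)
  open CommutativeSemigroupProperties +-commutativeSemigroup using ()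
    renaming (x∙yz≈y∙xz to x+[y+z]≈y+[x+z])
  open SetoidReasoning setoid

  private
    sgn : Fin n → Carrier
    sgn j = (- 1#) ^ toℕ j

    minor : Matrix Carrier (suc n) → Fin (suc n) → Matrix Carrier n
    minor M j r s = M (suc r) (punchIn j s)

    term : Matrix Carrier (suc n) → Fin (suc n) → Carrier
    term M j = sgn j * M 0F j * det (minor M j)

    sum-cong : (f g : Fin n → Carrier) → (∀ j → f j ≈ g j) → sum f ≈ sum g
    sum-cong f g = sum-cong-≋ {x = f} {y = g}

    sum-zero : (f : Fin n → Carrier) → (∀ j → f j ≈ 0#) → sum f ≈ 0#
    sum-zero {n} f f≈0 = trans (sum-cong f (λ _ → 0#) f≈0) (sum-replicate-zero n)

    sum-neg : (f : Fin n → Carrier) → sum (λ j → - f j) ≈ - sum f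
    sum-neg {zero}  f = sym -0#≈0#
    sum-neg {suc n} f = trans (+-congˡ (sum-neg (λ j → f (suc j)))) (-‿+-comm _ _)

    sgn₀-term : ∀ a d → 1# * a * d ≈ a * d
    sgn₀-term a d = *-congʳ (*-identityˡ a)

    sgn₁-term : ∀ a d → - 1# * 1# * a * d ≈ - (a * d)
    sgn₁-term a d = begin
      - 1# * 1# * a * d ≈⟨ *-congʳ (*-congʳ (*-identityʳ (- 1#))) ⟩
      - 1# * a * d      ≈⟨ *-congʳ (-1*x≈-x a) ⟩
      - a * d           ≈⟨ -‿distribˡ-* a d ⟨
      - (a * d)         ∎

  infix 8 _ᵀ
  _ᵀ : Matrix Carrier n → Matrix Carrier n
  (M ᵀ) i j = M j i

  det-cong : (M N : Matrix Carrier n) → (∀ i j → M i j ≈ N i j) → det M ≈ det N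
  det-cong {zero}  M N M≈N = refl
  det-cong {suc n} M N M≈N = sum-cong (term M) (term N) λ j →
    *-cong (*-congˡ {sgn j} (M≈N 0F j))
           (det-cong (minor M j) (minor N j) λ r s → M≈N (suc r) (punchIn j s))

  -- Expanding along the first row and then along the first columns of the
  -- minors gives an expression symmetric in rows and columns.
  det-ᵀ : (M : Matrix Carrier n) → det M ≈ det (M ᵀ)
  det-ᵀ {zero}        M = refl
  det-ᵀ {suc zero}    M = refl
  det-ᵀ {suc (suc n)} M = +-cong (*-congˡ {1# * M 0F 0F} (det-ᵀ (minor M 0F))) (begin
    (sum λ j → p j * det (minor M (suc j)))
      ≈⟨ sum-cong _ _ (λ j → *-congˡ {p j} (det-ᵀ (minor M (suc j)))) ⟩
    (sum λ j → p j * sum (row j))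
      ≈⟨ sum-cong _ _ (λ j → *-distribˡ-sum (p j) (row j)) ⟩
    (sum λ j → sum λ i → p j * row j i)
      ≈⟨ ∑-comm (λ j i → p j * row j i) ⟩
    (sum λ i → sum λ j → p j * row j i)
      ≈⟨ sum-cong _ _ (λ i → sum-cong _ _ λ j → trans
           (*-congˡ {p j} (*-congˡ {sgn i * M (suc i) 0F} (sym (det-ᵀ (inner i j)))))
           (exchange (sgn i) (sgn j) (M 0F (suc j)) (M (suc i) 0F) (det (inner i j)))) ⟩
    (sum λ i → sum λ j → q i * column i j)
      ≈⟨ sum-cong _ _ (λ i → *-distribˡ-sum (q i) (column i)) ⟨
    (sum λ i → q i * det (minor (M ᵀ) (suc i) ᵀ))
      ≈⟨ sum-cong _ _ (λ i → *-congˡ {q i} (det-ᵀ (minor (M ᵀ) (suc i)))) ⟨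
    (sum λ i → q i * det (minor (M ᵀ) (suc i)))
      ∎)
    where
    inner : Fin (suc n) → Fin (suc n) → Matrix Carrier n
    inner i j r s = M (suc (punchIn i r)) (suc (punchIn j s))

    p q : Fin (suc n) → Carrier
    p j = sgn (suc j) * M 0F (suc j)
    q i = sgn (suc i) * M (suc i) 0F

    row column : Fin (suc n) → Fin (suc n) → Carrier
    row j i    = sgn i * M (suc i) 0F * det (inner i j ᵀ)
    column i j = sgn j * M 0F (suc j) * det (inner i j)

    exchange : ∀ σ τ a b d → - 1# * τ * a * (σ * b * d) ≈ - 1# * σ * b * (τ * a * d)
    exchange σ τ a b d = begin
      - 1# * τ * a * (σ * b * d)     ≈⟨ *-cong (*-assoc _ _ _) refl ⟩
      - 1# * (τ * a) * (σ * b * d)   ≈⟨ *-assoc _ _ _ ⟩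
      - 1# * (τ * a * (σ * b * d))   ≈⟨ *-congˡ (x∙yz≈y∙xz _ _ _) ⟩
      - 1# * (σ * b * (τ * a * d))   ≈⟨ *-assoc _ _ _ ⟨
      - 1# * (σ * b) * (τ * a * d)   ≈⟨ *-congʳ (*-assoc _ _ _) ⟨
      - 1# * σ * b * (τ * a * d)     ∎

  det-row₀-additive : (M A B : Matrix Carrier (suc n)) →
    (∀ j → M 0F j ≈ A 0F j + B 0F j) →
    (∀ i j → M (suc i) j ≈ A (suc i) j) → (∀ i j → M (suc i) j ≈ B (suc i) j) →
    det M ≈ det A + det B
  det-row₀-additive M A B M₀≈A₀+B₀ M≈A M≈B = begin
    sum (term M)                    ≈⟨ sum-cong _ _ step ⟩
    sum (λ j → term A j + term B j) ≈⟨ ∑-distrib-+ (term A) (term B) ⟩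
    sum (term A) + sum (term B)    ∎
    where
    expand : ∀ σ a b d → σ * (a + b) * d ≈ σ * a * d + σ * b * d
    expand σ a b d = trans (*-congʳ (distribˡ σ a b)) (distribʳ d (σ * a) (σ * b))

    step : ∀ j → term M j ≈ term A j + term B j
    step j = begin
      sgn j * M 0F j * det (minor M j)
        ≈⟨ *-congʳ (*-congˡ {sgn j} (M₀≈A₀+B₀ j)) ⟩
      sgn j * (A 0F j + B 0F j) * det (minor M j)
        ≈⟨ expand (sgn j) (A 0F j) (B 0F j) (det (minor M j)) ⟩
      sgn j * A 0F j * det (minor M j) + sgn j * B 0F j * det (minor M j)
        ≈⟨ +-cong (*-congˡ {sgn j * A 0F j} (det-cong _ _ λ r s → M≈A r (punchIn j s)))
                  (*-congˡ {sgn j * B 0F j} (det-cong _ _ λ r s → M≈B r (punchIn j s))) ⟩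
      term A j + term B j
        ∎

  det-column₀-additive : (M A B : Matrix Carrier (suc n)) →
    (∀ i → M i 0F ≈ A i 0F + B i 0F) →
    (∀ i j → M i (suc j) ≈ A i (suc j)) → (∀ i j → M i (suc j) ≈ B i (suc j)) →
    det M ≈ det A + det B
  det-column₀-additive M A B M₀≈A₀+B₀ M≈A M≈B = begin
    det M                 ≈⟨ det-ᵀ M ⟩
    det (M ᵀ)             ≈⟨ det-row₀-additive (M ᵀ) (A ᵀ) (B ᵀ) M₀≈A₀+B₀ (λ i j → M≈A j i) (λ i j → M≈B j i) ⟩
    det (A ᵀ) + det (B ᵀ) ≈⟨ +-cong (det-ᵀ A) (det-ᵀ B) ⟨
    det A + det B         ∎

  -- Deleting column 0 or column 1 leaves the same minor, so the first two terms of the expansion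
  -- cancel. Every later minor still contains both columns and vanishes by recursion.
  det-equal-columns₀₁ : (M : Matrix Carrier (suc (suc n))) → (∀ i → M i 0F ≈ M i 1F) → det M ≈ 0#
  det-equal-columns₀₁ {n} M M₀≈M₁ = begin
    term M 0F + (term M 1F + sum (λ j → term M (suc (suc j))))
      ≈⟨ +-cong (*-cong (*-congˡ {1#} (M₀≈M₁ 0F)) (det-cong _ _ minors-agree))
                (+-congˡ {term M 1F} (sum-zero _ (later M M₀≈M₁))) ⟩
    1# * M 0F 1F * det (minor M 1F) + (- 1# * 1# * M 0F 1F * det (minor M 1F) + 0#)
      ≈⟨ cancel (M 0F 1F) (det (minor M 1F)) ⟩
    0# ∎
    where
    cancel : ∀ a d → 1# * a * d + (- 1# * 1# * a * d + 0#) ≈ 0#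
    cancel a d = trans
      (+-cong (sgn₀-term a d) (trans (+-identityʳ _) (sgn₁-term a d)))
      (-‿inverseʳ (a * d))

    minors-agree : ∀ r s → minor M 0F r s ≈ minor M 1F r s
    minors-agree r zero    = sym (M₀≈M₁ (suc r))
    minors-agree r (suc s) = refl

    -- A third column exists only in size three or more; generalising over `n` exposes the further
    -- successor, so that the minor again has columns 0 and 1.
    later : ∀ {n} (M : Matrix Carrier (suc (suc n))) → (∀ i → M i 0F ≈ M i 1F) →
            ∀ j → term M (suc (suc j)) ≈ 0#
    later {suc n} M M₀≈M₁ j =
      trans (*-congˡ {sgn (suc (suc j)) * M 0F (suc (suc j))} 
        (det-equal-columns₀₁ (minor M (suc (suc j))) λ i → M₀≈M₁ (suc i))) (zeroʳ _)

  det-equal-rows₀₁ : (M : Matrix Carrier (suc (suc n))) → (∀ j → M 0F j ≈ M 1F j) → det M ≈ 0#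
  det-equal-rows₀₁ M M₀≈M₁ = trans (det-ᵀ M) (det-equal-columns₀₁ (M ᵀ) M₀≈M₁)

  -- The swap exchanges the first two terms of the expansion, whose signs are opposite; every later
  -- minor undergoes the same swap and changes sign by recursion.
  det-swap-columns₀₁ : (M : Matrix Carrier (suc (suc n))) →
                       det (λ i j → M i (adjacentSwap 0 j)) ≈ - det M
  det-swap-columns₀₁ {n} M = begin
    term M′ 0F + (term M′ 1F + sum (λ j → term M′ (suc (suc j))))
      ≈⟨ +-cong (*-congˡ {1# * M 0F 1F} (det-cong (minor M′ 0F) (minor M 1F)
                  λ { r zero → refl ; r (suc s) → refl }))
                (+-cong (*-congˡ { - 1# * 1# * M 0F 0F} (det-cong (minor M′ 1F) (minor M 0F)
                          λ { r zero → refl ; r (suc s) → refl }))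
                        (trans (sum-cong _ _ (later M)) (sum-neg (λ j → term M (suc (suc j)))))) ⟩
    1# * M 0F 1F * det (minor M 1F) + (- 1# * 1# * M 0F 0F * det (minor M 0F) + - rest)
      ≈⟨ exchange (M 0F 0F) (M 0F 1F) (det (minor M 0F)) (det (minor M 1F)) rest ⟩
    - (1# * M 0F 0F * det (minor M 0F) + (- 1# * 1# * M 0F 1F * det (minor M 1F) + rest))
      ∎
    where
    M′ = λ i j → M i (adjacentSwap 0 j)
    rest = sum (λ j → term M (suc (suc j)))

    exchange : ∀ a b d e r → 1# * b * e + (- 1# * 1# * a * d + - r) ≈
                             - (1# * a * d + (- 1# * 1# * b * e + r))
    exchange a b d e r = begin
      1# * b * e + (- 1# * 1# * a * d + - r)
        ≈⟨ +-cong (sgn₀-term b e) (+-congʳ (sgn₁-term a d)) ⟩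
      b * e + (- (a * d) + - r)
        ≈⟨ x+[y+z]≈y+[x+z] _ _ _ ⟩
      - (a * d) + (b * e + - r)
        ≈⟨ +-congˡ (+-congʳ (-‿involutive (b * e))) ⟨
      - (a * d) + (- - (b * e) + - r)
        ≈⟨ +-congˡ (-‿+-comm _ _) ⟩
      - (a * d) + - (- (b * e) + r)
        ≈⟨ -‿+-comm _ _ ⟩
      - (a * d + (- (b * e) + r))
        ≈⟨ -‿cong (+-cong (sgn₀-term a d) (+-congʳ (sgn₁-term b e))) ⟨
      - (1# * a * d + (- 1# * 1# * b * e + r))
        ∎

    later : ∀ {n} (M : Matrix Carrier (suc (suc n))) (j : Fin n) →
            term (λ i j → M i (adjacentSwap 0 j)) (suc (suc j)) ≈ - term M (suc (suc j))
    later {suc n} M j = trans (*-congˡ {sgn (suc (suc j)) * M 0F (suc (suc j))} (trans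
      (det-cong (minor (λ i j → M i (adjacentSwap 0 j)) (suc (suc j)))
                (λ r s → minor M (suc (suc j)) r (adjacentSwap 0 s))
                λ { r zero → refl ; r (suc zero) → refl ; r (suc (suc s)) → refl })
      (det-swap-columns₀₁ (minor M (suc (suc j)))))) (sym (-‿distribʳ-* _ _))

  -- Expansion deletes row 0 only, so a swap of lower rows passes unchanged to every minor. This
  -- makes rows, not columns, suitable for the induction on `m`; the base case comes from columns by
  -- transposition.
  det-swap-rows : ∀ m (M : Matrix Carrier (m ℕ.+ suc (suc n))) →
                  det (λ i j → M (adjacentSwap m i) j) ≈ - det M
  det-swap-rows zero M = begin
    det (λ i j → M (adjacentSwap 0 i) j) ≈⟨ det-ᵀ (λ i j → M (adjacentSwap 0 i) j) ⟩
    det (λ i j → (M ᵀ) i (adjacentSwap 0 j)) ≈⟨ det-swap-columns₀₁ (M ᵀ) ⟩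
    - det (M ᵀ)                          ≈⟨ -‿cong (det-ᵀ M) ⟨
    - det M                              ∎
  det-swap-rows (suc m) M = trans
    (sum-cong _ _ λ j → trans (*-congˡ {sgn j * M 0F j} (det-swap-rows m (minor M j)))
                              (sym (-‿distribʳ-* (sgn j * M 0F j) (det (minor M j)))))
    (sum-neg (term M))

  det-swap : ∀ m (M : Matrix Carrier (m ℕ.+ suc (suc n))) →
             det (λ i j → M (adjacentSwap m i) (adjacentSwap m j)) ≈ det M
  det-swap m M = begin
    det (λ i j → M (adjacentSwap m i) (adjacentSwap m j)) ≈⟨ det-swap-rows m (λ i j → M i (adjacentSwap m j)) ⟩
    - det (λ i j → M i (adjacentSwap m j))  ≈⟨ -‿cong (det-ᵀ (λ i j → M i (adjacentSwap m j))) ⟩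
    - det (λ i j → (M ᵀ) (adjacentSwap m i) j) ≈⟨ -‿cong (det-swap-rows m (M ᵀ)) ⟩
    - - det (M ᵀ) ≈⟨ -‿involutive (det (M ᵀ)) ⟩
    det (M ᵀ)     ≈⟨ det-ᵀ M ⟨
    det M         ∎

  -- Subtract row 1 from row 0, which becomes (d , - d , 0 , …), and expand along it.
  det-merge : ∀ d (M : Matrix Carrier (suc (suc n))) (N : Matrix Carrier (suc n)) →
    M 0F 0F ≈ d + M 1F 0F → M 0F 1F ≈ - d + M 1F 1F →
    (∀ j → M 0F (suc (suc j)) ≈ M 1F (suc (suc j))) →
    (∀ i → N i 0F ≈ M (suc i) 0F + M (suc i) 1F) →
    (∀ i j → N i (suc j) ≈ M (suc i) (suc (suc j))) →
    det M ≈ d * det N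
  det-merge {n} d M N M₀₀ M₀₁ M₀ N₀ Nₛ = begin
    det M
      ≈⟨ det-row₀-additive M D E
           (λ { zero → M₀₀ ; (suc zero) → M₀₁ ; (suc (suc j)) → trans (M₀ j) (sym (+-identityˡ _)) })
           (λ i j → refl) (λ i j → refl) ⟩
    det D + det E
      ≈⟨ +-congˡ (det-equal-rows₀₁ E λ j → refl) ⟩
    det D + 0#
      ≈⟨ +-congʳ (+-congˡ {term D 0F} (+-congˡ {term D 1F} (sum-zero (λ j → term D (suc (suc j))) λ j →
            trans (*-congʳ (zeroʳ (sgn (suc (suc j))))) (zeroˡ _)))) ⟩
    1# * d * det (minor D 0F) + (- 1# * 1# * - d * det (minor D 1F) + 0#) + 0#
      ≈⟨ collect (det (minor D 0F)) (det (minor D 1F)) ⟩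
    d * (det (minor D 1F) + det (minor D 0F))
      -- The two minors differ only in column 0, where `minor D 1F` keeps column 0 of `M` and
      -- `minor D 0F` keeps column 1.
      ≈⟨ *-congˡ (det-column₀-additive N (minor D 1F) (minor D 0F) N₀ Nₛ Nₛ) ⟨
    d * det N
      ∎
    where
    row : Fin (suc (suc n)) → Carrier
    row zero          = d
    row (suc zero)    = - d
    row (suc (suc _)) = 0#

    D E : Matrix Carrier (suc (suc n))
    D zero    = row
    D (suc i) = M (suc i)
    E zero    = M 1F
    E (suc i) = M (suc i)

    collect : ∀ p q → 1# * d * p + (- 1# * 1# * - d * q + 0#) + 0# ≈ d * (q + p)
    collect p q = begin
      1# * d * p + (- 1# * 1# * - d * q + 0#) + 0#
        ≈⟨ +-identityʳ _ ⟩
      1# * d * p + (- 1# * 1# * - d * q + 0#)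
        ≈⟨ +-cong (sgn₀-term d p) (trans (+-identityʳ _) (sgn₁-term (- d) q)) ⟩
      d * p + - (- d * q)
        ≈⟨ +-congˡ (trans (-‿distribˡ-* (- d) q) (*-congʳ (-‿involutive d))) ⟩
      d * p + d * q
        ≈⟨ +-comm _ _ ⟩
      d * q + d * p
        ≈⟨ distribˡ d q p ⟨
      d * (q + p)
        ∎

-- Weighted matrices and merging

adjacentSwap-involutive : ∀ m (i : Fin (m ℕ.+ suc (suc n))) → adjacentSwap m (adjacentSwap m i) ≡ i
adjacentSwap-involutive zero    zero          = ≡.refl
adjacentSwap-involutive zero    (suc zero)    = ≡.refl
adjacentSwap-involutive zero    (suc (suc i)) = ≡.refl
adjacentSwap-involutive (suc m) zero          = ≡.refl
adjacentSwap-involutive (suc m) (suc i)       = ≡.cong suc (adjacentSwap-involutive m i)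

adjacentSwap-injective : ∀ m {i j : Fin (m ℕ.+ suc (suc n))} → adjacentSwap m i ≡ adjacentSwap m j → i ≡ j
adjacentSwap-injective m {i} {j} eq =
  ≡.trans (≡.sym (adjacentSwap-involutive m i)) (≡.trans (≡.cong (adjacentSwap m) eq) (adjacentSwap-involutive m j))

-- The pair (a , w) stands for w points with the label a, merged into one index:
-- its diagonal shift is still t a, but the columns of the w points add up.
weightedMatrix : (A → ℤ) → (A → A → ℤ) → (Fin n → A × ℕ) → Matrix ℤ n
weightedMatrix t V v i j =
  (if does (i ≟ j) then t (proj₁ (v i)) else + 0) ℤ.+ V (proj₁ (v i)) (proj₁ (v j)) ℤ.* + proj₂ (v j)

weightedMatrix-cong : (t : A → ℤ) (V : A → A → ℤ) {v w : Fin n → A × ℕ} → v ≗ w →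
                      ∀ i j → weightedMatrix t V v i j ≡ weightedMatrix t V w i j
weightedMatrix-cong t V v≗w i j rewrite v≗w i | v≗w j = ≡.refl

total : {X : Set} → (X → ℤ) → List X → ℤ
total g L = List.foldr ℤ._+_ (+ 0) (List.map g L)

module ℤΣ = CommutativeMonoidSum ℤₚ.+-0-commutativeMonoid

sum-tabulate : {X : Set} (g : X → ℤ) (v : Fin n → X) → ℤΣ.sum (g ∘ v) ≡ total g (tabulate v)
sum-tabulate {n = zero}  g v = ≡.refl
sum-tabulate {n = suc n} g v = ≡.cong (λ z → g (v zero) ℤ.+ z) (sum-tabulate g (v ∘ suc))

sum-δ : (i : Fin n) (h : Fin n → ℤ) → ℤΣ.sum (λ j → if does (i ≟ j) then h j else + 0) ≡ h i
sum-δ {n = suc n} zero h = ≡.trans (≡.cong (λ z → h zero ℤ.+ z) (ℤΣ.sum-replicate-zero n)) (ℤₚ.+-identityʳ (h zero))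
sum-δ (suc i) h = ≡.trans (ℤₚ.+-identityˡ _) (sum-δ i (h ∘ suc))

-- The contribution of one point to a block row sum, without the diagonal shift, which is the part
-- not additive in the weight.
blockWeight : (A → A → ℤ) → (A → Fin m) → A → Fin m → A × ℕ → ℤ
blockWeight V π a b (l , w) = if does (π l ≟ b) then V a l ℤ.* + w else + 0

blockWeight-additive : (V : A → A → ℤ) (π : A → Fin m) → ∀ a b l p q →
  blockWeight V π a b (l , p ℕ.+ q) ≡ blockWeight V π a b (l , p) ℤ.+ blockWeight V π a b (l , q)
blockWeight-additive V π a b l p q with does (π l ≟ b)
... | true  = ℤₚ.*-distribˡ-+ (V a l) (+ p) (+ q)
... | false = ≡.refl

-- Isolates the diagonal shift of row `i`, so that the other summand depends on the points only
-- through a `total`, to which `total-⟶` applies.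
weightedMatrix-blockSum : (t : A → ℤ) (V : A → A → ℤ) (π : A → Fin m) (v : Fin n → A × ℕ) → ∀ i b →
  ℤΣ.sum (λ j → if does (π (proj₁ (v j)) ≟ b) then weightedMatrix t V v i j else + 0) ≡
  (if does (π (proj₁ (v i)) ≟ b) then t (proj₁ (v i)) else + 0) ℤ.+
  total (blockWeight V π (proj₁ (v i)) b) (tabulate v)
weightedMatrix-blockSum t V π v i b = begin
  ℤΣ.sum (λ j → if does (π (proj₁ (v j)) ≟ b) then weightedMatrix t V v i j else + 0)
    ≡⟨ ℤΣ.sum-cong-≗ split ⟩
  ℤΣ.sum (λ j → (if does (i ≟ j) then diagonal j else + 0) ℤ.+ blockWeight V π a b (v j))
    ≡⟨ ℤΣ.∑-distrib-+ (λ j → if does (i ≟ j) then diagonal j else + 0) (blockWeight V π a b ∘ v) ⟩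
  ℤΣ.sum (λ j → if does (i ≟ j) then diagonal j else + 0) ℤ.+ ℤΣ.sum (blockWeight V π a b ∘ v)
    ≡⟨ ≡.cong₂ ℤ._+_ (sum-δ i diagonal) (sum-tabulate (blockWeight V π a b) v) ⟩
  diagonal i ℤ.+ total (blockWeight V π a b) (tabulate v)
    ∎
  where
  open ≡.≡-Reasoning
  a = proj₁ (v i)

  diagonal : Fin _ → ℤ
  diagonal j = if does (π (proj₁ (v j)) ≟ b) then t a else + 0

  split : ∀ j → (if does (π (proj₁ (v j)) ≟ b) then weightedMatrix t V v i j else + 0) ≡
                (if does (i ≟ j) then diagonal j else + 0) ℤ.+ blockWeight V π a b (v j)
  split j with does (π (proj₁ (v j)) ≟ b) | does (i ≟ j)
  ... | true  | true  = ≡.refl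
  ... | true  | false = ≡.refl
  ... | false | true  = ≡.refl
  ... | false | false = ≡.refl

-- Reductions of lists of weighted points

module Merging {A : Set} (t : A → ℤ) (s : ℤ) where

  infix 4 _⟶[_]_
  -- The index counts merges, each of which contributes one factor `x - s` to the characteristic
  -- polynomial. Composition adds as `q + p`, so that appending a single merge gives `suc` by
  -- computation.
  data _⟶[_]_ : List (A × ℕ) → ℕ → List (A × ℕ) → Set where
    permute : ∀ {L L′} → L ↭ L′ → L ⟶[ 0 ] L′
    merge   : ∀ {a} p q L → t a ≡ s → (a , p) ∷ (a , q) ∷ L ⟶[ 1 ] (a , p ℕ.+ q) ∷ L
    _⨾_     : ∀ {L L′ L″ p q} → L ⟶[ p ] L′ → L′ ⟶[ q ] L″ → L ⟶[ q ℕ.+ p ] L″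

  -- A merge acts on the first two points only; the new head is carried behind the pair and brought
  -- back afterwards.
  ⟶-∷ : ∀ {L L′ r} x → L ⟶[ r ] L′ → x ∷ L ⟶[ r ] x ∷ L′
  ⟶-∷ x (permute L↭L′) = permute (prep x L↭L′)
  ⟶-∷ x (merge {a} p q L ta≡s) =
    (permute (↭-sym (Perm.shift x ((a , p) ∷ (a , q) ∷ []) L)) ⨾ merge p q (x ∷ L) ta≡s)
    ⨾ permute (swap _ _ Perm.refl)
  ⟶-∷ x (red₁ ⨾ red₂) = ⟶-∷ x red₁ ⨾ ⟶-∷ x red₂

  -- The tail is merged before the head joins it, so the weights add up as `w + suc r * w`, which is
  -- `suc (suc r) * w` by computation.
  merge-replicate : ∀ {a} w → t a ≡ s → ∀ r L →
                    replicate (suc r) (a , w) ++ L ⟶[ r ] (a , suc r ℕ.* w) ∷ L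
  merge-replicate {a} w ta≡s zero L =
    permute (↭-reflexive (≡.cong (λ u → (a , u) ∷ L) (≡.sym (ℕ.*-identityˡ w))))
  merge-replicate w ta≡s (suc r) L =
    ⟶-∷ _ (merge-replicate w ta≡s r L) ⨾ merge w _ L ta≡s

  merge-blocks : {I : Set} (b : I → A) (f : I → ℕ) → (∀ i → t (b i) ≡ s) → ∀ is →
                 concatMap (λ i → replicate (suc (f i)) (b i , 1)) is
                   ⟶[ sumℕ (List.map f is) ]
                 List.map (λ i → b i , suc (f i)) is
  merge-blocks b f tb≡s []       = permute Perm.refl
  merge-blocks b f tb≡s (i ∷ is) =
    ≡.subst (λ r → copies ++ rest ⟶[ r ] merged) (ℕ.+-comm (sumℕ (List.map f is)) (f i))
      (≡.subst (λ w → copies ++ rest ⟶[ f i ] (b i , w) ∷ rest) (ℕ.*-identityʳ (suc (f i)))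
         (merge-replicate 1 (tb≡s i) (f i) rest)
       ⨾ ⟶-∷ _ (merge-blocks b f tb≡s is))
    where
    copies = replicate (suc (f i)) (b i , 1)
    rest = concatMap (λ i → replicate (suc (f i)) (b i , 1)) is
    merged = List.map (λ i → b i , suc (f i)) (i ∷ is)

  -- Each merge removes exactly one point. A multiplicity can thus be found by comparing lengths
  -- instead of evaluating a sum over hyperedges.
  length-⟶ : ∀ {L L′ r} → L ⟶[ r ] L′ → length L ≡ r ℕ.+ length L′
  length-⟶ (permute L↭L′)   = Perm.↭-length L↭L′
  length-⟶ (merge _ _ _ _)  = ≡.refl
  length-⟶ {L} {L″} (_⨾_ {p = p} {q = q} red₁ red₂) = begin
    length L                   ≡⟨ length-⟶ red₁ ⟩
    p ℕ.+ _                    ≡⟨ ≡.cong (p ℕ.+_) (length-⟶ red₂) ⟩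
    p ℕ.+ (q ℕ.+ length L″)    ≡⟨ ℕ.+-assoc p q _ ⟨
    (p ℕ.+ q) ℕ.+ length L″    ≡⟨ ≡.cong (ℕ._+ length L″) (ℕ.+-comm p q) ⟩
    (q ℕ.+ p) ℕ.+ length L″    ∎
    where open ≡.≡-Reasoning

  module _ (g : A × ℕ → ℤ) (g-additive : ∀ a p q → g (a , p ℕ.+ q) ≡ g (a , p) ℤ.+ g (a , q)) where

    total-↭ : ∀ {L L′} → L ↭ L′ → total g L ≡ total g L′
    total-↭ Perm.refl           = ≡.refl
    total-↭ (prep x L↭L′)       = ≡.cong (λ z → g x ℤ.+ z) (total-↭ L↭L′)
    total-↭ (swap x y L↭L′)     = ≡.trans (≡.cong (λ z → g x ℤ.+ (g y ℤ.+ z)) (total-↭ L↭L′))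
      (CommutativeSemigroupProperties.x∙yz≈y∙xz ℤₚ.+-commutativeSemigroup (g x) (g y) _)
    total-↭ (Perm.trans p q)    = ≡.trans (total-↭ p) (total-↭ q)

    total-⟶ : ∀ {L L′ r} → L ⟶[ r ] L′ → total g L ≡ total g L′
    total-⟶ (permute L↭L′)         = total-↭ L↭L′
    total-⟶ (merge {a} p q L ta≡s) = ≡.sym (≡.trans
      (≡.cong (ℤ._+ total g L) (g-additive a p q)) (ℤₚ.+-assoc (g (a , p)) _ _))
    total-⟶ (red₁ ⨾ red₂)          = ≡.trans (total-⟶ red₁) (total-⟶ red₂)

-- Characteristic polynomials of weighted matrices

module CharPoly (K : HeytingField c ℓ₁ ℓ₂) where
  open Determinant K
  open Spectral K using (fromℤ; charPoly)
  private
    commutativeRing = HeytingCommutativeRing.commutativeRing (HeytingField.heytingCommutativeRing K)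
  open CommutativeRing commutativeRing
  open AbelianGroupProperties +-abelianGroup using (⁻¹-∙-comm; ε⁻¹≈ε)
  open CommutativeSemigroupProperties +-commutativeSemigroup using (interchange; x∙yz≈y∙xz)
  open SemiringExp semiring using (_^_; ^-homo-*)
  open SemiringMult semiring using (×-homo-+) renaming (_×_ to _·_)
  open SetoidReasoning setoid

  sub-+ : ∀ a b c d → (a + c) - (b + d) ≈ (a - b) + (c - d)
  sub-+ a b c d = trans (+-congˡ (sym (⁻¹-∙-comm b d))) (interchange a c (- b) (- d))

  fromℤ-⊖ : ∀ m n → fromℤ (m ℤ.⊖ n) ≈ m · 1# - n · 1#
  fromℤ-⊖ m       zero    = sym (trans (+-congˡ ε⁻¹≈ε) (+-identityʳ _))
  fromℤ-⊖ zero    (suc n) = sym (+-identityˡ _)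
  fromℤ-⊖ (suc m) (suc n) = begin
    fromℤ (suc m ℤ.⊖ suc n)           ≡⟨ ≡.cong fromℤ (ℤₚ.[1+m]⊖[1+n]≡m⊖n m n) ⟩
    fromℤ (m ℤ.⊖ n)                   ≈⟨ fromℤ-⊖ m n ⟩
    m · 1# - n · 1#                   ≈⟨ +-identityˡ _ ⟨
    0# + (m · 1# - n · 1#)            ≈⟨ +-congʳ (-‿inverseʳ 1#) ⟨
    (1# - 1#) + (m · 1# - n · 1#)     ≈⟨ sub-+ 1# 1# (m · 1#) (n · 1#) ⟨
    (1# + m · 1#) - (1# + n · 1#)     ∎

  fromℤ-+ : ∀ i j → fromℤ (i ℤ.+ j) ≈ fromℤ i + fromℤ j
  fromℤ-+ (+ m)      (+ n)      = ×-homo-+ 1# m n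
  fromℤ-+ (+ m)      -[1+ n ]   = fromℤ-⊖ m (suc n)
  fromℤ-+ -[1+ m ]   (+ n)      = trans (fromℤ-⊖ n (suc m)) (+-comm _ _)
  fromℤ-+ -[1+ m ]   -[1+ n ]   = begin
    - (suc (suc (m ℕ.+ n)) · 1#)        ≡⟨ ≡.cong (λ k → - (suc k · 1#)) (ℕ.+-suc m n) ⟨
    - ((suc m ℕ.+ suc n) · 1#)          ≈⟨ -‿cong (×-homo-+ 1# (suc m) (suc n)) ⟩
    - (suc m · 1# + suc n · 1#)         ≈⟨ ⁻¹-∙-comm _ _ ⟨
    - (suc m · 1#) + - (suc n · 1#)     ∎

  private
    charMatrix : Carrier → Matrix ℤ n → Matrix Carrier n
    charMatrix x M i j = (if does (i ≟ j) then x else 0#) - fromℤ (M i j)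

  charPoly-cong : ∀ x (M N : Matrix ℤ n) → (∀ i j → M i j ≡ N i j) → charPoly M x ≈ charPoly N x
  charPoly-cong x M N M≡N =
    det-cong (charMatrix x M) (charMatrix x N) λ i j →
      reflexive (≡.cong (λ z → (if does (i ≟ j) then x else 0#) - fromℤ z) (M≡N i j))

  module _ (t : A → ℤ) (V : A → A → ℤ) (x : Carrier) where

    weightedPoly : (Fin n → A × ℕ) → Carrier
    weightedPoly v = charPoly (weightedMatrix t V v) x

    weightedPoly-cong : {v w : Fin n → A × ℕ} → v ≗ w → weightedPoly v ≈ weightedPoly w
    weightedPoly-cong v≗w = charPoly-cong x _ _ (weightedMatrix-cong t V v≗w)

    -- The index types `Fin (length (tabulate v))` and `Fin n` agree only propositionally;
    -- `viaLength` abstracts the list and its length so that the equation can be matched with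
    -- `refl`.
    weightedPoly-tabulate : (v : Fin n → A × ℕ) → weightedPoly (List.lookup (tabulate v)) ≈ weightedPoly v
    weightedPoly-tabulate v =
      viaLength (tabulate v) (List.length-tabulate v) v (List.lookup-tabulate v)
      where
      viaLength : ∀ L (eq : length L ≡ n) (v : Fin n → A × ℕ) →
                  (∀ i → List.lookup L (cast (≡.sym eq) i) ≡ v i) →
                  weightedPoly (List.lookup L) ≈ weightedPoly v
      viaLength L ≡.refl v lookup≡v = weightedPoly-cong λ i →
        ≡.trans (≡.cong (List.lookup L) (≡.sym (cast-is-id ≡.refl i))) (lookup≡v i)

    weightedPoly-adjacentSwap : ∀ m (v : Fin (m ℕ.+ suc (suc n)) → A × ℕ) →
                                weightedPoly (v ∘ adjacentSwap m) ≈ weightedPoly v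
    weightedPoly-adjacentSwap m v = trans
      (det-cong (charMatrix x (weightedMatrix t V v′))
         (λ i j → entries (adjacentSwap m i) (adjacentSwap m j)) λ i j →
         reflexive (≡.cong (λ b → (if b then x else 0#) - fromℤ
             ((if b then t (proj₁ (v′ i)) else + 0) ℤ.+ V (proj₁ (v′ i)) (proj₁ (v′ j)) ℤ.* + proj₂ (v′ j)))
           (does-⇔ (mk⇔ (≡.cong (adjacentSwap m)) (adjacentSwap-injective m))
             (i ≟ j) (adjacentSwap m i ≟ adjacentSwap m j))))
      (det-swap m entries)
      where
      v′ = v ∘ adjacentSwap m

      entries : Matrix Carrier _
      entries = charMatrix x (weightedMatrix t V v)

    listPoly : List (A × ℕ) → Carrier
    listPoly L = weightedPoly (List.lookup L)

    listPoly-swap : ∀ zs a b L → listPoly (zs ++ a ∷ b ∷ L) ≈ listPoly (zs ++ b ∷ a ∷ L)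
    listPoly-swap zs a b L = begin
      listPoly (zs ++ a ∷ b ∷ L)                    ≡⟨ ≡.cong listPoly (tabulate-points zs) ⟨
      listPoly (tabulate (points zs))               ≈⟨ weightedPoly-tabulate (points zs) ⟩
      weightedPoly (points zs)                      ≈⟨ weightedPoly-adjacentSwap (length zs) (points zs) ⟨
      weightedPoly (points zs ∘ adjacentSwap (length zs)) ≈⟨ weightedPoly-tabulate (points zs ∘ adjacentSwap (length zs)) ⟨
      listPoly (tabulate (points zs ∘ adjacentSwap (length zs))) ≡⟨ ≡.cong listPoly (tabulate-points-swapped zs) ⟩
      listPoly (zs ++ b ∷ a ∷ L)                    ∎
      where
      -- The list indexed by a sum of the shape that `adjacentSwap` demands; the length of
      -- `zs ++ a ∷ b ∷ L` has this shape only propositionally.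
      points : ∀ zs → Fin (length zs ℕ.+ suc (suc (length L))) → A × ℕ
      points []       = List.lookup (a ∷ b ∷ L)
      points (z ∷ zs) zero    = z
      points (z ∷ zs) (suc i) = points zs i

      tabulate-points : ∀ zs → tabulate (points zs) ≡ zs ++ a ∷ b ∷ L
      tabulate-points []       = List.tabulate-lookup (a ∷ b ∷ L)
      tabulate-points (z ∷ zs) = ≡.cong (z ∷_) (tabulate-points zs)

      tabulate-points-swapped : ∀ zs → tabulate (points zs ∘ adjacentSwap (length zs)) ≡ zs ++ b ∷ a ∷ L
      tabulate-points-swapped []       = List.tabulate-lookup (b ∷ a ∷ L)
      tabulate-points-swapped (z ∷ zs) = ≡.cong (z ∷_) (tabulate-points-swapped zs)

    -- The polynomial of a list is not a function of that of its tail, so `prep` cannot be treated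
    -- by congruence. The prefix `zs` absorbs the common heads instead.
    listPoly-↭ : ∀ zs {L L′} → L ↭ L′ → listPoly (zs ++ L) ≈ listPoly (zs ++ L′)
    listPoly-↭ zs Perm.refl = refl
    listPoly-↭ zs {_ ∷ L} {_ ∷ L′} (prep a L↭L′) = begin
      listPoly (zs ++ a ∷ L)         ≡⟨ ≡.cong listPoly (List.∷ʳ-++ zs a L) ⟨
      listPoly (zs List.∷ʳ a ++ L)   ≈⟨ listPoly-↭ (zs List.∷ʳ a) L↭L′ ⟩
      listPoly (zs List.∷ʳ a ++ L′)  ≡⟨ ≡.cong listPoly (List.∷ʳ-++ zs a L′) ⟩
      listPoly (zs ++ a ∷ L′)        ∎
    listPoly-↭ zs {_ ∷ _ ∷ L} {_ ∷ _ ∷ L′} (swap a b L↭L′) = begin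
      listPoly (zs ++ a ∷ b ∷ L)              ≈⟨ listPoly-swap zs a b L ⟩
      listPoly (zs ++ b ∷ a ∷ L)              ≡⟨ ≡.cong listPoly (List.++-assoc zs (b ∷ a ∷ []) L) ⟨
      listPoly ((zs ++ b ∷ a ∷ []) ++ L)      ≈⟨ listPoly-↭ (zs ++ b ∷ a ∷ []) L↭L′ ⟩
      listPoly ((zs ++ b ∷ a ∷ []) ++ L′)     ≡⟨ ≡.cong listPoly (List.++-assoc zs (b ∷ a ∷ []) L′) ⟩
      listPoly (zs ++ b ∷ a ∷ L′)             ∎
    listPoly-↭ zs (Perm.trans L↭L′ L′↭L″) = trans (listPoly-↭ zs L↭L′) (listPoly-↭ zs L′↭L″)

    -- An entry involves the weight of its column but not that of its row. Rows with equal labels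
    -- therefore agree up to the diagonal shift even when their weights differ, as `det-merge`
    -- requires.
    listPoly-merge : ∀ a p q L →
      listPoly ((a , p) ∷ (a , q) ∷ L) ≈ (x - fromℤ (t a)) * listPoly ((a , p ℕ.+ q) ∷ L)
    listPoly-merge a p q L = det-merge (x - u)
      (charMatrix x (weightedMatrix t V (List.lookup ((a , p) ∷ (a , q) ∷ L))))
      (charMatrix x (weightedMatrix t V (List.lookup ((a , p ℕ.+ q) ∷ L))))
      (row₀ p) (trans (sym (-‿inverseˡ-cancel (x - u) _)) (+-congˡ (sym (row₀ q))))
      (λ j → refl)
      (λ { zero → column₀ ; (suc i) → column (V (proj₁ (List.lookup L i)) a) })
      (λ { zero j → refl ; (suc i) j → refl })
      where
      u = fromℤ (t a)

      off : ℤ → ℕ → Carrier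
      off v w = 0# - fromℤ (+ 0 ℤ.+ v ℤ.* + w)

      -‿inverseˡ-cancel : ∀ y z → - y + (y + z) ≈ z
      -‿inverseˡ-cancel y z = trans (sym (+-assoc _ _ _)) (trans (+-congʳ (-‿inverseˡ y)) (+-identityˡ z))

      row₀ : ∀ w → x - fromℤ (t a ℤ.+ V a a ℤ.* + w) ≈ (x - u) + off (V a a) w
      row₀ w = begin
        x - fromℤ (t a ℤ.+ V a a ℤ.* + w)        ≈⟨ +-cong (sym (+-identityʳ x)) (-‿cong (fromℤ-+ (t a) _)) ⟩
        (x + 0#) - (u + fromℤ (V a a ℤ.* + w))   ≈⟨ sub-+ x u 0# _ ⟩
        (x - u) + (0# - fromℤ (V a a ℤ.* + w))   ≡⟨ ≡.cong (λ z → (x - u) + (0# - fromℤ z)) (ℤₚ.+-identityˡ (V a a ℤ.* + w)) ⟨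
        (x - u) + off (V a a) w                  ∎

      column : ∀ v → off v (p ℕ.+ q) ≈ off v p + off v q
      column v = begin
        off v (p ℕ.+ q)
          ≡⟨ ≡.cong (λ z → 0# - fromℤ z) (≡.trans (ℤₚ.+-identityˡ _)
               (≡.trans (ℤₚ.*-distribˡ-+ v (+ p) (+ q))
               (≡.sym (≡.cong₂ ℤ._+_ (ℤₚ.+-identityˡ (v ℤ.* + p)) (ℤₚ.+-identityˡ (v ℤ.* + q)))))) ⟩
        0# - fromℤ ((+ 0 ℤ.+ v ℤ.* + p) ℤ.+ (+ 0 ℤ.+ v ℤ.* + q))
          ≈⟨ +-cong (sym (+-identityˡ 0#)) (-‿cong (fromℤ-+ (+ 0 ℤ.+ v ℤ.* + p) _)) ⟩
        (0# + 0#) - (fromℤ (+ 0 ℤ.+ v ℤ.* + p) + fromℤ (+ 0 ℤ.+ v ℤ.* + q))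
          ≈⟨ sub-+ 0# _ 0# _ ⟩
        off v p + off v q
          ∎

      column₀ : x - fromℤ (t a ℤ.+ V a a ℤ.* + (p ℕ.+ q)) ≈ off (V a a) p + (x - fromℤ (t a ℤ.+ V a a ℤ.* + q))
      column₀ = begin
        x - fromℤ (t a ℤ.+ V a a ℤ.* + (p ℕ.+ q))      ≈⟨ row₀ (p ℕ.+ q) ⟩
        (x - u) + off (V a a) (p ℕ.+ q)                 ≈⟨ +-congˡ (column (V a a)) ⟩
        (x - u) + (off (V a a) p + off (V a a) q)       ≈⟨ x∙yz≈y∙xz _ _ _ ⟩
        off (V a a) p + ((x - u) + off (V a a) q)       ≈⟨ +-congˡ (row₀ q) ⟨
        off (V a a) p + (x - fromℤ (t a ℤ.+ V a a ℤ.* + q)) ∎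

    module _ {s : ℤ} where
      open Merging t s

      listPoly-⟶ : ∀ {L L′ r} → L ⟶[ r ] L′ → listPoly L ≈ (x - fromℤ s) ^ r * listPoly L′
      listPoly-⟶ (permute L↭L′) = trans (listPoly-↭ [] L↭L′) (sym (*-identityˡ _))
      listPoly-⟶ (merge {a} p q L ≡.refl) = trans (listPoly-merge a p q L) (*-congʳ (sym (*-identityʳ _)))
      listPoly-⟶ {L} {L″} (_⨾_ {L′ = L′} {p = p} {q = q} red₁ red₂) = begin
        listPoly L                                         ≈⟨ listPoly-⟶ red₁ ⟩
        (x - fromℤ s) ^ p * listPoly L′                    ≈⟨ *-congˡ (listPoly-⟶ red₂) ⟩
        (x - fromℤ s) ^ p * ((x - fromℤ s) ^ q * listPoly L″) ≈⟨ *-assoc _ _ _ ⟨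
        (x - fromℤ s) ^ p * (x - fromℤ s) ^ q * listPoly L″ ≈⟨ *-congʳ (*-comm _ _) ⟩
        (x - fromℤ s) ^ q * (x - fromℤ s) ^ p * listPoly L″ ≈⟨ *-congʳ (^-homo-* (x - fromℤ s) q p) ⟨
        (x - fromℤ s) ^ (q ℕ.+ p) * listPoly L″            ∎

      weightedPoly-⟶ : ∀ {r} (v : Fin m → A × ℕ) (w : Fin n → A × ℕ) → tabulate v ⟶[ r ] tabulate w →
                       weightedPoly v ≈ (x - fromℤ s) ^ r * weightedPoly w
      weightedPoly-⟶ {r = r} v w v⟶w = begin
        weightedPoly v                          ≈⟨ weightedPoly-tabulate v ⟨
        listPoly (tabulate v)                   ≈⟨ listPoly-⟶ v⟶w ⟩
        (x - fromℤ s) ^ r * listPoly (tabulate w) ≈⟨ *-congˡ (weightedPoly-tabulate w) ⟩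
        (x - fromℤ s) ^ r * weightedPoly w      ∎

-- Vertices of the double hyperstar

open import Data.Nat.Base using (_+_; _*_)
open ≡ using (refl; sym; trans; cong; cong₂; subst)

does-∈? : (i : Fin n) (p : Subset n) → does (i ∈? p) ≡ Vec.lookup p i
does-∈? zero    (true ∷ p)  = refl
does-∈? zero    (false ∷ p) = refl
does-∈? (suc i) (_ ∷ p)     = does-∈? i p

lookup-∅ : (i : Fin n) → Vec.lookup ∅ i ≡ false
lookup-∅ i = Vec.lookup-replicate i false

lookup-⁅⁆ : (x i : Fin n) → Vec.lookup ⁅ x ⁆ i ≡ does (i ≟ x)
lookup-⁅⁆ zero    zero    = refl
lookup-⁅⁆ zero    (suc i) = lookup-∅ i
lookup-⁅⁆ (suc x) zero    = refl
lookup-⁅⁆ (suc x) (suc i) = lookup-⁅⁆ x i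

lookup-concat-replicate : ∀ r (p : Subset m) (q : Fin (m ℕ.* r)) →
  Vec.lookup (Vec.concat (Vec.map (Vec.replicate r) p)) q ≡ Vec.lookup p (quotient r q)
lookup-concat-replicate {m} r p q = begin
  Vec.lookup (Vec.concat xss) q
    ≡⟨ cong (Vec.lookup (Vec.concat xss)) (combine-remQuot {m} r q) ⟨
  Vec.lookup (Vec.concat xss) (combine i j)
    ≡⟨ Vec.lookup-concat xss i j ⟩
  Vec.lookup (Vec.lookup xss i) j
    ≡⟨ cong (λ xs → Vec.lookup xs j) (Vec.lookup-map i (Vec.replicate r) p) ⟩
  Vec.lookup (Vec.replicate r (Vec.lookup p i)) j
    ≡⟨ Vec.lookup-replicate j _ ⟩
  Vec.lookup p i
    ∎
  where
  open ≡-Reasoning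
  xss = Vec.map (Vec.replicate r) p
  i = quotient {m} r q
  j = remainder {m} r q

↑ˡ≢↑ʳ : (i : Fin m) (j : Fin n) → i ↑ˡ n ≢ m ↑ʳ j
↑ˡ≢↑ʳ {m} {n} i j eq
  with () ← trans (sym (splitAt-↑ˡ m i n)) (trans (cong (splitAt m) eq) (splitAt-↑ʳ m n j))

∣tabulate-false∣ : ∀ n (f : Fin n → Bool) → (∀ e → f e ≡ false) → ∣ Vec.tabulate f ∣ ≡ 0
∣tabulate-false∣ zero    f f≡false = refl
∣tabulate-false∣ (suc n) f f≡false rewrite f≡false zero = ∣tabulate-false∣ n (f ∘ suc) (f≡false ∘ suc)

-- For a vertex whose only hyperedge is `i`, the number of hyperedges shared with a second vertex
-- reduces to one membership test.
∣tabulate-≟∧∣ : (i : Fin n) (f : Fin n → Bool) →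
                ∣ Vec.tabulate (λ e → does (i ≟ e) ∧ f e) ∣ ≡ (if f i then 1 else 0)
∣tabulate-≟∧∣ {suc n} zero f with f zero
... | true  = cong suc (∣tabulate-false∣ n _ λ _ → refl)
... | false = ∣tabulate-false∣ n _ λ _ → refl
∣tabulate-≟∧∣ (suc i) f = ∣tabulate-≟∧∣ i (f ∘ suc)

tabulate-splitAt : ∀ m (f : Fin m → A) (g : Fin n → A) →
                   tabulate ([ f , g ]′ ∘ splitAt m) ≡ tabulate f ++ tabulate g
tabulate-splitAt zero    f g = refl
tabulate-splitAt (suc m) f g = cong (f zero ∷_)
  (trans (List.tabulate-cong λ i → [,]-map (splitAt m i)) (tabulate-splitAt m (f ∘ suc) g))

tabulate-const : ∀ n (x : A) → tabulate {n = n} (const x) ≡ replicate n x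
tabulate-const zero    x = refl
tabulate-const (suc n) x = cong (x ∷_) (tabulate-const n x)

tabulate-quotient : ∀ m n (f : Fin m → A) →
                    tabulate (f ∘ quotient {m} n) ≡ concatMap (replicate n ∘ f) (allFin m)
tabulate-quotient zero    n f = refl
tabulate-quotient (suc m) n f = begin
  tabulate (f ∘ quotient {suc m} n)
    ≡⟨ List.tabulate-cong quotient-suc ⟩
  tabulate ([ const (f zero) , f ∘ suc ∘ quotient {m} n ]′ ∘ splitAt n)
    ≡⟨ tabulate-splitAt n (const (f zero)) (f ∘ suc ∘ quotient {m} n) ⟩
  tabulate {n = n} (const (f zero)) ++ tabulate (f ∘ suc ∘ quotient {m} n)
    ≡⟨ cong₂ _++_ (tabulate-const n (f zero)) (tabulate-quotient m n (f ∘ suc)) ⟩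
  replicate n (f zero) ++ concatMap (replicate n ∘ f ∘ suc) (allFin m)
    ≡⟨ cong (replicate n (f zero) ++_) (List.concatMap-map (replicate n ∘ f) suc (allFin m)) ⟨
  replicate n (f zero) ++ concatMap (replicate n ∘ f) (List.map suc (allFin m))
    ≡⟨ cong (λ es → replicate n (f zero) ++ concatMap (replicate n ∘ f) es) (List.map-tabulate (λ i → i) suc) ⟩
  concatMap (replicate n ∘ f) (allFin (suc m))
    ∎
  where
  open ≡-Reasoning
  quotient-suc : ∀ q → f (quotient {suc m} n q) ≡ [ const (f zero) , f ∘ suc ∘ quotient {m} n ]′ (splitAt n q)
  quotient-suc q with splitAt n q
  ... | inj₁ _ = refl
  ... | inj₂ _ = refl

-- Moves the leaf of each edge next to the new vertices of that edge: the power lists all old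
-- vertices before the blocks of new ones.
concatMap-replicate-suc : {B : Set} (f : B → A) → ∀ r es →
  List.map f es ++ concatMap (replicate r ∘ f) es ↭ concatMap (replicate (suc r) ∘ f) es
concatMap-replicate-suc f r []       = Perm.refl
concatMap-replicate-suc f r (e ∷ es) = prep (f e) (Perm.trans
  (Perm.shifts (List.map f es) (replicate r (f e)))
  (Perm.++⁺ˡ (replicate r (f e)) (concatMap-replicate-suc f r es)))

-- The entry of the Seidel matrix between two vertices of the given classes (in
-- the order of block) that are distinct and, in the classes 1F and 3F, lie in
-- different hyperedges.  The value at (0F , 0F) and (2F , 2F), where no such
-- vertices exist, makes the diagonal shift of a centre 1.
classSign : Fin 5 → Fin 5 → ℤ
classSign i j = Vec.lookup (Vec.lookup rows i) j
  where
  rows : Vec.Vec (Vec.Vec ℤ 5) 5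
  rows =
      (-[1+ 0 ] ∷ -[1+ 0 ] ∷ -[1+ 0 ] ∷ + 1      ∷ -[1+ 0 ] ∷ [])
    ∷ (-[1+ 0 ] ∷ + 1      ∷ + 1      ∷ + 1      ∷ + 1      ∷ [])
    ∷ (-[1+ 0 ] ∷ + 1      ∷ -[1+ 0 ] ∷ -[1+ 0 ] ∷ -[1+ 0 ] ∷ [])
    ∷ (+ 1      ∷ + 1      ∷ -[1+ 0 ] ∷ + 1      ∷ + 1      ∷ [])
    ∷ (-[1+ 0 ] ∷ + 1      ∷ -[1+ 0 ] ∷ + 1      ∷ -[1+ 0 ] ∷ [])
    ∷ []

-- The Seidel matrix in terms of labels

module DoubleHyperstar (m₁ m₂ r : ℕ) where

  G : Hypergraph
  G = doubleHyperstar (suc m₁) (suc m₂) (2 ℕ.+ r)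

  open Hypergraph G using (Vertex; size; edge)

  private
    graph = doubleStar (suc m₁) (suc m₂)
    module DS = Graph graph

  -- The two centres, followed by one label for the degree-one vertices of each hyperedge.
  Label : Set
  Label = Fin (2 ℕ.+ size)

  starLabel : Label → (Fin m → Label) → Fin (suc m) → Label
  starLabel centre leaf zero    = centre
  starLabel centre leaf (suc i) = leaf i

  edge₁ : Fin m₁ → Fin size
  edge₁ i = suc (i ↑ˡ m₂)

  edge₂ : Fin m₂ → Fin size
  edge₂ i = suc (m₁ ↑ʳ i)

  inEdge : Fin size → Label
  inEdge e = suc (suc e)

  oldLabel : Fin (suc m₁) ⊎ Fin (suc m₂) → Label
  oldLabel = [ starLabel 0F (inEdge ∘ edge₁) , starLabel 1F (inEdge ∘ edge₂) ]′

  label : Vertex → Label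
  label = [ oldLabel ∘ splitAt (suc m₁) , inEdge ∘ quotient r ]′ ∘ splitAt (suc m₁ ℕ.+ suc m₂)

  class : Label → Fin 5
  class zero                = 0F
  class (suc zero)          = 2F
  class (suc (suc zero))    = 4F
  class (suc (suc (suc e))) = [ const 1F , const 3F ]′ (splitAt m₁ e)

  class-label : ∀ i → block (suc m₁) (suc m₂) (2 ℕ.+ r) i ≡ class (label i)
  class-label i with splitAt (suc m₁ ℕ.+ suc m₂) i
  class-label i | inj₁ x with splitAt (suc m₁) x
  ... | inj₁ zero    = refl
  ... | inj₁ (suc f) = cong [ const 1F , const 3F ]′ (sym (splitAt-↑ˡ m₁ f m₂))
  ... | inj₂ zero    = refl
  ... | inj₂ (suc f) = cong [ const 1F , const 3F ]′ (sym (splitAt-↑ʳ m₁ m₂ f))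
  class-label i | inj₂ q with quotient {size} r q
  ... | zero  = refl
  ... | suc e = refl

  incident : Label → Fin size → Bool
  incident zero          zero    = true
  incident zero          (suc e) = [ const true , const false ]′ (splitAt m₁ e)
  incident (suc zero)    zero    = true
  incident (suc zero)    (suc e) = [ const false , const true ]′ (splitAt m₁ e)
  incident (suc (suc f)) e       = does (f ≟ e)

  lookup-oldEdge : ∀ e x → Vec.lookup (DS.edge e) x ≡ incident (oldLabel (splitAt (suc m₁) x)) e
  lookup-oldEdge zero x =
    trans (Vec.lookup-splitAt (suc m₁) ⁅ 0F ⁆ ⁅ 0F ⁆ x) (bridge-lookup (splitAt (suc m₁) x))
    where
    bridge-lookup : ∀ s → [ Vec.lookup ⁅ 0F ⁆ , Vec.lookup ⁅ 0F ⁆ ]′ s ≡ incident (oldLabel s) zero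
    bridge-lookup (inj₁ zero)    = refl
    bridge-lookup (inj₁ (suc f)) = lookup-∅ f
    bridge-lookup (inj₂ zero)    = refl
    bridge-lookup (inj₂ (suc f)) = lookup-∅ f
  lookup-oldEdge (suc e) x = begin
    Vec.lookup (Bridge.oldEdge (star (suc m₁)) (star (suc m₂)) 0F 0F (splitAt m₁ e)) x
      ≡⟨ star-lookup (splitAt m₁ e) x ⟩
    starIncident (oldLabel (splitAt (suc m₁) x)) (splitAt m₁ e)
      ≡⟨ starIncident≡incident (oldLabel (splitAt (suc m₁) x)) ⟩
    incident (oldLabel (splitAt (suc m₁) x)) (suc e)
      ∎
    where
    open ≡-Reasoning

    -- `incident` on the star edges with the edge index already split, so that the edges of the two
    -- stars are separated by constructors.
    starIncident : Label → Fin m₁ ⊎ Fin m₂ → Bool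
    starIncident zero          = [ const true , const false ]′
    starIncident (suc zero)    = [ const false , const true ]′
    starIncident (suc (suc f)) s = does (f ≟ suc (join m₁ m₂ s))

    starIncident≡incident : ∀ l → starIncident l (splitAt m₁ e) ≡ incident l (suc e)
    starIncident≡incident zero          = refl
    starIncident≡incident (suc zero)    = refl
    starIncident≡incident (suc (suc f)) = cong (λ e → does (f ≟ suc e)) (join-splitAt m₁ m₂ e)

    star-lookup : ∀ s x → Vec.lookup (Bridge.oldEdge (star (suc m₁)) (star (suc m₂)) 0F 0F s) x ≡
                          starIncident (oldLabel (splitAt (suc m₁) x)) s
    star-lookup (inj₁ g) x = trans (Vec.lookup-splitAt (suc m₁) (inside ∷ ⁅ g ⁆) ∅ x) (sides (splitAt (suc m₁) x))
      where
      sides : ∀ s → [ Vec.lookup (inside ∷ ⁅ g ⁆) , Vec.lookup ∅ ]′ s ≡ starIncident (oldLabel s) (inj₁ g)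
      sides (inj₁ zero)    = refl
      sides (inj₁ (suc f)) = trans (lookup-⁅⁆ g f)
        (does-⇔ (mk⇔ (cong (_↑ˡ m₂)) (↑ˡ-injective m₂ f g)) (f ≟ g) (f ↑ˡ m₂ ≟ g ↑ˡ m₂))
      sides (inj₂ zero)    = refl
      sides (inj₂ (suc f)) = trans (lookup-∅ f)
        (sym (dec-false (m₁ ↑ʳ f ≟ g ↑ˡ m₂) (↑ˡ≢↑ʳ g f ∘ sym)))
    star-lookup (inj₂ g) x = trans (Vec.lookup-splitAt (suc m₁) ∅ (inside ∷ ⁅ g ⁆) x) (sides (splitAt (suc m₁) x))
      where
      sides : ∀ s → [ Vec.lookup ∅ , Vec.lookup (inside ∷ ⁅ g ⁆) ]′ s ≡ starIncident (oldLabel s) (inj₂ g)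
      sides (inj₁ zero)    = refl
      sides (inj₁ (suc f)) = trans (lookup-∅ f)
        (sym (dec-false (f ↑ˡ m₂ ≟ m₁ ↑ʳ g) (↑ˡ≢↑ʳ f g)))
      sides (inj₂ zero)    = refl
      sides (inj₂ (suc f)) = trans (lookup-⁅⁆ g f)
        (does-⇔ (mk⇔ (cong (m₁ ↑ʳ_)) (↑ʳ-injective m₁ f g)) (f ≟ g) (m₁ ↑ʳ f ≟ m₁ ↑ʳ g))

  does-∈?-edge : ∀ i e → does (i ∈? edge e) ≡ incident (label i) e
  does-∈?-edge i e = trans (does-∈? i (edge e)) (trans
    (Vec.lookup-splitAt (suc m₁ ℕ.+ suc m₂) (DS.edge e) (Vec.concat (Vec.map (Vec.replicate r) ⁅ e ⁆)) i)
    (sides (splitAt (suc m₁ ℕ.+ suc m₂) i)))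
    where
    sides : ∀ s →
      [ Vec.lookup (DS.edge e) , Vec.lookup (Vec.concat (Vec.map (Vec.replicate r) ⁅ e ⁆)) ]′ s ≡
      incident ([ oldLabel ∘ splitAt (suc m₁) , inEdge ∘ quotient r ]′ s) e
    sides (inj₁ x) = lookup-oldEdge e x
    sides (inj₂ q) = trans (lookup-concat-replicate r ⁅ e ⁆ q) (lookup-⁅⁆ e (quotient r q))

  centre₁ centre₂ : Vertex
  centre₁ = (zero {m₁} ↑ˡ suc m₂) ↑ˡ (size ℕ.* r)
  centre₂ = (suc m₁ ↑ʳ zero {m₂}) ↑ˡ (size ℕ.* r)

  -- A centre shares its label with no other vertex. This rules out the pairs at which the sign of a
  -- centre label with itself would have to be a genuine Seidel entry.
  label-centre₁ : ∀ i → label i ≡ 0F → centre₁ ≡ i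
  label-centre₁ i eq with splitAt (suc m₁ ℕ.+ suc m₂) i in eq₁
  label-centre₁ i eq | inj₁ x with splitAt (suc m₁) x in eq₂
  label-centre₁ i eq | inj₁ x | inj₁ zero =
    trans (cong (_↑ˡ (size ℕ.* r)) (splitAt⁻¹-↑ˡ eq₂)) (splitAt⁻¹-↑ˡ eq₁)
  label-centre₁ i () | inj₁ x | inj₂ zero
  label-centre₁ i () | inj₁ x | inj₂ (suc _)

  label-centre₂ : ∀ i → label i ≡ 1F → centre₂ ≡ i
  label-centre₂ i eq with splitAt (suc m₁ ℕ.+ suc m₂) i in eq₁
  label-centre₂ i eq | inj₁ x with splitAt (suc m₁) x in eq₂
  label-centre₂ i () | inj₁ x | inj₁ zero
  label-centre₂ i () | inj₁ x | inj₁ (suc _)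
  label-centre₂ i eq | inj₁ x | inj₂ zero =
    trans (cong (_↑ˡ (size ℕ.* r)) (splitAt⁻¹-↑ʳ eq₂)) (splitAt⁻¹-↑ˡ eq₁)

  -- Off the diagonal this is the Seidel matrix; a vertex has the sign -1 with
  -- itself, so that the diagonal needs the shift 1.
  labelSign : Label → Label → ℤ
  labelSign a b = if does (a ≟ b) then -[1+ 0 ] else classSign (class a) (class b)

  common : Label → Label → ℕ
  common a b = ∣ Vec.tabulate (λ e → incident a e ∧ incident b e) ∣

  common-comm : ∀ a b → common a b ≡ common b a
  common-comm a b = cong ∣_∣ (Vec.tabulate-cong λ e → ∧-comm (incident a e) (incident b e))

  classSign-comm : ∀ a b → classSign a b ≡ classSign b a
  classSign-comm = from-yes (all? λ a → all? λ b → classSign a b ℤₚ.≟ classSign b a)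

  -- The `+ 0` stands for the off-diagonal entry of the identity matrix; keeping it makes this the
  -- off-diagonal value of `seidel` by computation.
  seidelEntry : ℕ → ℤ
  seidelEntry c = + 1 ℤ.- + 0 ℤ.- + 2 ℤ.* + c

  -- Degree one is what matters: the only hyperedge that can be shared is `f` itself, so the entry
  -- is -1 or 1 according to whether `b` is incident with `f`.
  seidelEntry-edge : ∀ f b → seidelEntry (common (inEdge f) b) ≡ labelSign (inEdge f) b
  seidelEntry-edge f b = trans (cong seidelEntry (∣tabulate-≟∧∣ f (incident b))) (entry f b)
    where
    entry : ∀ f b → seidelEntry (if incident b f then 1 else 0) ≡ labelSign (inEdge f) b
    entry zero    zero          = refl
    entry zero    (suc zero)    = refl
    entry (suc f) zero          with splitAt m₁ f
    ... | inj₁ _ = refl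
    ... | inj₂ _ = refl
    entry (suc f) (suc zero)    with splitAt m₁ f
    ... | inj₁ _ = refl
    ... | inj₂ _ = refl
    entry zero    (suc (suc zero))    = refl
    entry zero    (suc (suc (suc g))) with splitAt m₁ g
    ... | inj₁ _ = refl
    ... | inj₂ _ = refl
    entry (suc f) (suc (suc zero))    with splitAt m₁ f
    ... | inj₁ _ = refl
    ... | inj₂ _ = refl
    entry (suc f) (suc (suc (suc g))) with f ≟ g
    ... | yes refl rewrite dec-true (f ≟ f) refl = refl
    ... | no f≢g rewrite dec-false (g ≟ f) (f≢g ∘ sym) with splitAt m₁ f | splitAt m₁ g
    ...   | inj₁ _ | inj₁ _ = refl
    ...   | inj₁ _ | inj₂ _ = refl
    ...   | inj₂ _ | inj₁ _ = refl
    ...   | inj₂ _ | inj₂ _ = refl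

  seidelEntry-centres : seidelEntry (common 0F 1F) ≡ labelSign 0F 1F
  -- The `suc` counts the hyperedge through both centres; no hyperedge of a star contains the two of
  -- them.
  seidelEntry-centres = cong (seidelEntry ∘ suc) (∣tabulate-false∣ (m₁ ℕ.+ m₂) _ disjoint)
    where
    disjoint : ∀ e → incident 0F (suc e) ∧ incident 1F (suc e) ≡ false
    disjoint e with splitAt m₁ e
    ... | inj₁ _ = refl
    ... | inj₂ _ = refl

  labelSign-comm : ∀ a b → labelSign a b ≡ labelSign b a
  labelSign-comm a b = cong₂ (if_then -[1+ 0 ] else_)
    (does-⇔ (mk⇔ sym sym) (a ≟ b) (b ≟ a)) (classSign-comm (class a) (class b))

  seidelEntry-label : ∀ i j → i ≢ j → seidelEntry (common (label i) (label j)) ≡ labelSign (label i) (label j)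
  seidelEntry-label i j i≢j with label i in eqᵢ | label j in eqⱼ
  ... | suc (suc f) | b           = seidelEntry-edge f b
  ... | zero        | zero        = contradiction (trans (sym (label-centre₁ i eqᵢ)) (label-centre₁ j eqⱼ)) i≢j
  ... | zero        | suc zero    = seidelEntry-centres
  ... | suc zero    | zero        = trans (cong seidelEntry (common-comm 1F 0F)) seidelEntry-centres
  ... | suc zero    | suc zero    = contradiction (trans (sym (label-centre₂ i eqᵢ)) (label-centre₂ j eqⱼ)) i≢j
  ... | zero        | suc (suc g) = trans (cong seidelEntry (common-comm 0F (inEdge g)))
    (trans (seidelEntry-edge g 0F) (labelSign-comm (inEdge g) 0F))
  ... | suc zero    | suc (suc g) = trans (cong seidelEntry (common-comm 1F (inEdge g)))
    (trans (seidelEntry-edge g 1F) (labelSign-comm (inEdge g) 1F))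

  vertexPoint : Vertex → Label × ℕ
  vertexPoint i = label i , 1

  seidel≡weightedMatrix : ∀ i j → seidel G i j ≡ weightedMatrix (const (+ 1)) labelSign vertexPoint i j
  seidel≡weightedMatrix i j with i ≟ j
  ... | yes refl rewrite dec-true (label i ≟ label i) refl = refl
  ... | no i≢j = begin
    seidelEntry ∣ Vec.tabulate (λ e → does (i ∈? edge e) ∧ does (j ∈? edge e)) ∣
      ≡⟨ cong (seidelEntry ∘ ∣_∣) (Vec.tabulate-cong λ e → cong₂ _∧_ (does-∈?-edge i e) (does-∈?-edge j e)) ⟩
    seidelEntry (common (label i) (label j))
      ≡⟨ seidelEntry-label i j i≢j ⟩
    s
      ≡⟨ *-identity s ⟨
    + 0 ℤ.+ s ℤ.* + 1
      ∎
    where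
    open ≡-Reasoning
    s = labelSign (label i) (label j)
    *-identity : ∀ s → + 0 ℤ.+ s ℤ.* + 1 ≡ s
    *-identity = solve-∀

-- The two quotients

-- Here n₁ = `p₁ + 2`, n₂ = `p₂ + 2` and k = `κ + 3`. Every class is then visibly non-empty, and
-- merges are counted without truncated subtraction.
module Quotients (p₁ p₂ κ : ℕ) where
  private
    m₁ = suc p₁
    m₂ = suc p₂
    r  = suc κ
    k  = 2 + r

  open DoubleHyperstar m₁ m₂ r
  open Hypergraph G using (size)

  -- One less than the number of degree-one vertices of a hyperedge.
  surplus : Fin size → ℕ
  surplus zero    = κ
  surplus (suc e) = suc κ

  totalSurplus : ℕ
  totalSurplus = sumℕ (List.map surplus (allFin size))

  labelSize : Label → ℕ
  labelSize zero          = 1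
  labelSize (suc zero)    = 1
  labelSize (suc (suc e)) = suc (surplus e)

  labelPoint : Label → Label × ℕ
  labelPoint l = l , labelSize l

  classPoint : Label → Fin 5 × ℕ
  classPoint l = class l , labelSize l

  classSize : Fin 5 → ℕ
  classSize 0F = 1
  classSize 1F = m₁ * suc r
  classSize 2F = 1
  classSize 3F = m₂ * suc r
  classSize 4F = r

  quotientPoint : Fin 5 → Fin 5 × ℕ
  quotientPoint b = b , classSize b

  leafShift : ℤ
  leafShift = ℤ.- (+ 2) ℤ.* + k ℤ.+ + 3

  -- The merged matrix has the entry 1 - (k - 1) on the diagonal of a class of
  -- degree-one vertices and k - 1 elsewhere; the difference is 3 - 2k.
  classShift : Fin 5 → ℤ
  classShift 0F = + 1
  classShift 1F = leafShift
  classShift 2F = + 1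
  classShift 3F = leafShift
  classShift 4F = + 1

  -- Merging needs equal labels to be adjacent, whereas a leaf and the new vertices of its hyperedge
  -- lie far apart in the order of the vertices. The hyperedge through the centres has no leaf,
  -- hence `r` copies of its label against `suc r` of the others.
  tabulate-label : tabulate label ↭
                   0F ∷ 1F ∷ concatMap (λ e → replicate (suc (surplus e)) (inEdge e)) (allFin size)
  tabulate-label = begin
    tabulate label
      ≡⟨ tabulate-splitAt (suc m₁ + suc m₂) (oldLabel ∘ splitAt (suc m₁)) (inEdge ∘ quotient r) ⟩
    tabulate (oldLabel ∘ splitAt (suc m₁)) ++ tabulate (inEdge ∘ quotient {size} r)
      ≡⟨ cong₂ _++_ (tabulate-splitAt (suc m₁) (starLabel 0F leaf₁) (starLabel 1F leaf₂))
                    (tabulate-quotient size r inEdge) ⟩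
    0F ∷ (tabulate leaf₁ ++ 1F ∷ tabulate leaf₂) ++ new
      ↭⟨ prep 0F (Perm.++⁺ʳ new (Perm.shift 1F (tabulate leaf₁) (tabulate leaf₂))) ⟩
    0F ∷ 1F ∷ (tabulate leaf₁ ++ tabulate leaf₂) ++ new
      ≡⟨ cong (λ ls → 0F ∷ 1F ∷ ls ++ new) leaves ⟩
    0F ∷ 1F ∷ List.map starEdge es ++ (replicate r 2F ++ concatMap (replicate r ∘ inEdge) (tabulate suc))
      ≡⟨ cong (λ ls → 0F ∷ 1F ∷ List.map starEdge es ++ (replicate r 2F ++ ls)) (reindex (λ _ → r)) ⟩
    0F ∷ 1F ∷ List.map starEdge es ++ (replicate r 2F ++ concatMap (replicate r ∘ starEdge) es)
      ↭⟨ prep 0F (prep 1F (Perm.shifts (List.map starEdge es) (replicate r 2F))) ⟩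
    0F ∷ 1F ∷ replicate r 2F ++ (List.map starEdge es ++ concatMap (replicate r ∘ starEdge) es)
      ↭⟨ prep 0F (prep 1F (Perm.++⁺ˡ (replicate r 2F) (concatMap-replicate-suc starEdge r es))) ⟩
    0F ∷ 1F ∷ replicate r 2F ++ concatMap (replicate (suc r) ∘ starEdge) es
      ≡⟨ cong (λ ls → 0F ∷ 1F ∷ replicate r 2F ++ ls) (reindex (suc ∘ surplus)) ⟨
    0F ∷ 1F ∷ concatMap (λ e → replicate (suc (surplus e)) (inEdge e)) (allFin size)
      ∎
    where
    open Perm.PermutationReasoning
    leaf₁ = inEdge ∘ edge₁
    leaf₂ = inEdge ∘ edge₂
    new = concatMap (replicate r ∘ inEdge) (allFin size)
    es = allFin (m₁ + m₂)

    starEdge : Fin (m₁ + m₂) → Label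
    starEdge e = inEdge (suc e)

    leaves : tabulate leaf₁ ++ tabulate leaf₂ ≡ List.map starEdge es
    leaves = trans (sym (tabulate-splitAt m₁ leaf₁ leaf₂))
      (trans (List.tabulate-cong λ e → trans (sym ([,]-∘ starEdge (splitAt m₁ e)))
                (cong starEdge (join-splitAt m₁ m₂ e)))
             (sym (List.map-tabulate (λ e → e) starEdge)))

    reindex : ∀ (f : Fin size → ℕ) →
      concatMap (λ e → replicate (f e) (inEdge e)) (tabulate suc) ≡
      concatMap (λ e → replicate (f (suc e)) (starEdge e)) es
    reindex f = trans
      (cong (concatMap (λ e → replicate (f e) (inEdge e))) (sym (List.map-tabulate (λ e → e) suc)))
      (List.concatMap-map (λ e → replicate (f e) (inEdge e)) suc es)

  module V→L = Merging {Label} (const (+ 1)) (+ 1)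
  module L→C = Merging {Fin 5} classShift leafShift

  vertices⟶labels : tabulate vertexPoint V→L.⟶[ totalSurplus ] tabulate labelPoint
  vertices⟶labels =
    subst (tabulate vertexPoint V→L.⟶[_] tabulate labelPoint) (ℕ.+-identityʳ _)
      (V→L.permute points
       V→L.⨾ subst (λ L → (0F , 1) ∷ (1F , 1) ∷ copies V→L.⟶[ totalSurplus ] (0F , 1) ∷ (1F , 1) ∷ L)
               (List.map-tabulate (λ e → e) (λ e → inEdge e , suc (surplus e)))
               (V→L.⟶-∷ _ (V→L.⟶-∷ _ (V→L.merge-blocks inEdge surplus (λ _ → refl) (allFin size)))))
    where
    copies = concatMap (λ e → replicate (suc (surplus e)) (inEdge e , 1)) (allFin size)

    points : tabulate vertexPoint ↭ (0F , 1) ∷ (1F , 1) ∷ copies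
    points = begin
      tabulate vertexPoint
        ≡⟨ List.map-tabulate label (_, 1) ⟨
      List.map (_, 1) (tabulate label)
        ↭⟨ Perm.map⁺ (_, 1) tabulate-label ⟩
      (0F , 1) ∷ (1F , 1) ∷ List.map (_, 1) (concatMap (λ e → replicate (suc (surplus e)) (inEdge e)) (allFin size))
        ≡⟨ cong (λ L → (0F , 1) ∷ (1F , 1) ∷ L) (trans
             (List.map-concatMap (_, 1) (λ e → replicate (suc (surplus e)) (inEdge e)) (allFin size))
             (List.concatMap-cong (λ e → List.map-replicate (_, 1) (suc (surplus e)) (inEdge e)) (allFin size))) ⟩
      (0F , 1) ∷ (1F , 1) ∷ copies
        ∎
      where open Perm.PermutationReasoning

  -- Only the classes `3F` and `1F` contain several labels, `suc p₂` and `suc p₁` of them, all of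
  -- weight k - 1; each is brought to the front in turn. The list `centres` also holds the hyperedge
  -- through the centres, already alone in its class.
  classes⟶quotient : tabulate classPoint L→C.⟶[ p₁ + p₂ ] tabulate quotientPoint
  classes⟶quotient =
    subst (tabulate classPoint L→C.⟶[_] tabulate quotientPoint) (cong₂ _+_ (ℕ.+-identityʳ p₁) (ℕ.+-identityʳ p₂))
      ((L→C.permute toFront
        L→C.⨾ L→C.merge-replicate w refl p₂ (replicate m₁ (1F , w) ++ centres))
       L→C.⨾ ((L→C.permute (Perm.↭-sym (Perm.shift (3F , m₂ * w) (replicate m₁ (1F , w)) centres))
               L→C.⨾ L→C.merge-replicate w refl p₁ ((3F , m₂ * w) ∷ centres))
              L→C.⨾ L→C.permute reorder))
    where
    w = suc r
    centres = (0F , 1) ∷ (2F , 1) ∷ (4F , r) ∷ []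

    toFront : tabulate classPoint ↭ replicate m₂ (3F , w) ++ replicate m₁ (1F , w) ++ centres
    toFront = begin
      tabulate classPoint
        ≡⟨ cong (centres ++_) (trans
             (List.tabulate-cong λ e → [,]-∘ (_, w) {g = const 1F} {h = const 3F} (splitAt m₁ e))
             (trans (tabulate-splitAt m₁ (const (1F , w)) (const (3F , w)))
                    (cong₂ _++_ (tabulate-const m₁ (1F , w)) (tabulate-const m₂ (3F , w))))) ⟩
      centres ++ replicate m₁ (1F , w) ++ replicate m₂ (3F , w)
        ≡⟨ List.++-assoc centres (replicate m₁ (1F , w)) _ ⟨
      (centres ++ replicate m₁ (1F , w)) ++ replicate m₂ (3F , w)
        ↭⟨ Perm.++-comm (centres ++ replicate m₁ (1F , w)) _ ⟩
      replicate m₂ (3F , w) ++ (centres ++ replicate m₁ (1F , w))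
        ↭⟨ Perm.++⁺ˡ (replicate m₂ (3F , w)) (Perm.++-comm centres _) ⟩
      replicate m₂ (3F , w) ++ replicate m₁ (1F , w) ++ centres
        ∎
      where open Perm.PermutationReasoning

    reorder : (1F , m₁ * w) ∷ (3F , m₂ * w) ∷ centres ↭ tabulate quotientPoint
    reorder = Perm.trans
      (prep _ (Perm.trans (Perm.swap _ _ Perm.refl) (prep _ (Perm.swap _ _ Perm.refl)))) (Perm.swap _ _ Perm.refl)

  labelMatrix : Matrix ℤ (2 + size)
  labelMatrix = weightedMatrix (const (+ 1)) labelSign labelPoint

  -- Once a single index stands for each hyperedge, the exceptional sign -1 of a label with itself
  -- occurs on the diagonal only. It can be moved into the shift, after which the sign is a function
  -- of the classes and the second round of merging becomes possible.
  labelMatrix≡classMatrix : ∀ i j → labelMatrix i j ≡ weightedMatrix classShift classSign classPoint i j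
  labelMatrix≡classMatrix i j with i ≟ j
  ... | no _     = refl
  ... | yes refl = diagonal i
    where
    leafDiagonal : ∀ x → + 1 ℤ.+ -[1+ 0 ] ℤ.* (+ 2 ℤ.+ x) ≡
                   (ℤ.- (+ 2) ℤ.* (+ 3 ℤ.+ x) ℤ.+ + 3) ℤ.+ + 1 ℤ.* (+ 2 ℤ.+ x)
    leafDiagonal = solve-∀

    diagonal : ∀ i → + 1 ℤ.+ -[1+ 0 ] ℤ.* + labelSize i ≡
                     classShift (class i) ℤ.+ classSign (class i) (class i) ℤ.* + labelSize i
    diagonal zero             = refl
    diagonal (suc zero)       = refl
    diagonal (suc (suc zero)) = refl
    diagonal (suc (suc (suc e))) with splitAt m₁ e
    ... | inj₁ _ = leafDiagonal (+ κ)
    ... | inj₂ _ = leafDiagonal (+ κ)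

  classMatrix≡quotientMatrix : ∀ i j → weightedMatrix classShift classSign quotientPoint i j ≡
                                       quotientMatrix (suc m₁) (suc m₂) k i j
  classMatrix≡quotientMatrix = entries
    where
    neg-one : ∀ w → + 0 ℤ.+ -[1+ 0 ] ℤ.* w ≡ ℤ.- w
    neg-one = solve-∀

    one : ∀ w → + 0 ℤ.+ + 1 ℤ.* w ≡ w
    one = solve-∀

    cast-size : ∀ p → + (suc p ℕ.* suc r) ≡ ((+ 2 ℤ.+ + p) ℤ.- + 1) ℤ.* (+ k ℤ.- + 1)
    cast-size p = trans (ℤₚ.pos-* (suc p) (suc r)) (shift (+ p) (+ κ))
      where
      shift : ∀ p κ → (+ 1 ℤ.+ p) ℤ.* (+ 2 ℤ.+ κ) ≡ ((+ 2 ℤ.+ p) ℤ.- + 1) ℤ.* ((+ 3 ℤ.+ κ) ℤ.- + 1)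
      shift = solve-∀

    diagonal : ∀ p → leafShift ℤ.+ + 1 ℤ.* + (suc p ℕ.* suc r) ≡ ((+ 2 ℤ.+ + p) ℤ.- + 3) ℤ.* (+ k ℤ.- + 1) ℤ.+ + 1
    diagonal p = trans (cong (λ z → leafShift ℤ.+ + 1 ℤ.* z) (cast-size p)) (shift (+ p) (+ κ))
      where
      shift : ∀ p κ → (ℤ.- (+ 2) ℤ.* (+ 3 ℤ.+ κ) ℤ.+ + 3) ℤ.+ + 1 ℤ.* (((+ 2 ℤ.+ p) ℤ.- + 1) ℤ.* ((+ 3 ℤ.+ κ) ℤ.- + 1)) ≡
                      ((+ 2 ℤ.+ p) ℤ.- + 3) ℤ.* ((+ 3 ℤ.+ κ) ℤ.- + 1) ℤ.+ + 1
      shift = solve-∀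

    plus : ∀ p → + 0 ℤ.+ + 1 ℤ.* + (suc p ℕ.* suc r) ≡ ((+ 2 ℤ.+ + p) ℤ.- + 1) ℤ.* (+ k ℤ.- + 1)
    plus p = trans (one _) (cast-size p)

    minus : ∀ p → + 0 ℤ.+ -[1+ 0 ] ℤ.* + (suc p ℕ.* suc r) ≡ ℤ.- (((+ 2 ℤ.+ + p) ℤ.- + 1) ℤ.* (+ k ℤ.- + 1))
    minus p = trans (neg-one _) (cong ℤ.-_ (cast-size p))

    bridge⁻ : + 0 ℤ.+ -[1+ 0 ] ℤ.* + r ≡ + 2 ℤ.- + k
    bridge⁻ = shift (+ κ)
      where
      shift : ∀ κ → + 0 ℤ.+ -[1+ 0 ] ℤ.* (+ 1 ℤ.+ κ) ≡ + 2 ℤ.- (+ 3 ℤ.+ κ)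
      shift = solve-∀

    bridge⁺ : + 0 ℤ.+ + 1 ℤ.* + r ≡ + k ℤ.- + 2
    bridge⁺ = shift (+ κ)
      where
      shift : ∀ κ → + 0 ℤ.+ + 1 ℤ.* (+ 1 ℤ.+ κ) ≡ (+ 3 ℤ.+ κ) ℤ.- + 2
      shift = solve-∀

    bridge-diagonal : + 1 ℤ.+ -[1+ 0 ] ℤ.* + r ≡ + 3 ℤ.- + k
    bridge-diagonal = shift (+ κ)
      where
      shift : ∀ κ → + 1 ℤ.+ -[1+ 0 ] ℤ.* (+ 1 ℤ.+ κ) ≡ + 3 ℤ.- (+ 3 ℤ.+ κ)
      shift = solve-∀

    entries : ∀ i j → weightedMatrix classShift classSign quotientPoint i j ≡
                      quotientMatrix (suc m₁) (suc m₂) k i j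
    entries 0F 0F = refl
    entries 0F 1F = minus p₁
    entries 0F 2F = refl
    entries 0F 3F = plus p₂
    entries 0F 4F = bridge⁻
    entries 1F 0F = refl
    entries 1F 1F = diagonal p₁
    entries 1F 2F = refl
    entries 1F 3F = plus p₂
    entries 1F 4F = bridge⁺
    entries 2F 0F = refl
    entries 2F 1F = plus p₁
    entries 2F 2F = refl
    entries 2F 3F = minus p₂
    entries 2F 4F = bridge⁻
    entries 3F 0F = refl
    entries 3F 1F = plus p₁
    entries 3F 2F = refl
    entries 3F 3F = diagonal p₂
    entries 3F 4F = bridge⁺
    entries 4F 0F = refl
    entries 4F 1F = plus p₁
    entries 4F 2F = refl
    entries 4F 3F = plus p₂
    entries 4F 4F = bridge-diagonal

  -- Both reductions preserve block row sums. Between them the sum is turned back into a sum of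
  -- matrix entries, because `labelMatrix≡classMatrix` equates entries while shifts and signs differ
  -- separately. At the end each block is a single index.
  seidel-quotient : IsQuotientMatrix (seidel G) (block (suc m₁) (suc m₂) k) (quotientMatrix (suc m₁) (suc m₂) k)
  seidel-quotient i b = begin
    ℤΣ.sum (λ j → if does (block (suc m₁) (suc m₂) k j ≟ b) then seidel G i j else + 0)
      ≡⟨ ℤΣ.sum-cong-≗ (λ j → cong₂ (λ c z → if does (c ≟ b) then z else + 0)
           (class-label j) (seidel≡weightedMatrix i j)) ⟩
    ℤΣ.sum (λ j → if does (class (label j) ≟ b)
                  then weightedMatrix (const (+ 1)) labelSign vertexPoint i j else + 0)
      ≡⟨ weightedMatrix-blockSum (const (+ 1)) labelSign class vertexPoint i b ⟩
    δ (+ 1) ℤ.+ total (blockWeight labelSign class l b) (tabulate vertexPoint)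
      ≡⟨ cong (λ z → δ (+ 1) ℤ.+ z) (V→L.total-⟶ (blockWeight labelSign class l b)
           (blockWeight-additive labelSign class l b) vertices⟶labels) ⟩
    δ (+ 1) ℤ.+ total (blockWeight labelSign class l b) (tabulate labelPoint)
      ≡⟨ weightedMatrix-blockSum (const (+ 1)) labelSign class labelPoint l b ⟨
    ℤΣ.sum (λ j → if does (class j ≟ b) then labelMatrix l j else + 0)
      ≡⟨ ℤΣ.sum-cong-≗ (λ j → cong (λ z → if does (class j ≟ b) then z else + 0) (labelMatrix≡classMatrix l j)) ⟩
    ℤΣ.sum (λ j → if does (class j ≟ b) then weightedMatrix classShift classSign classPoint l j else + 0)
      ≡⟨ weightedMatrix-blockSum classShift classSign (λ c → c) classPoint l b ⟩
    δ (classShift (class l)) ℤ.+ total (blockWeight classSign (λ c → c) (class l) b) (tabulate classPoint)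
      ≡⟨ cong (λ z → δ (classShift (class l)) ℤ.+ z)
           (L→C.total-⟶ (blockWeight classSign (λ c → c) (class l) b)
             (blockWeight-additive classSign (λ c → c) (class l) b) classes⟶quotient) ⟩
    δ (classShift (class l)) ℤ.+ total (blockWeight classSign (λ c → c) (class l) b) (tabulate quotientPoint)
      ≡⟨ weightedMatrix-blockSum classShift classSign (λ c → c) quotientPoint (class l) b ⟨
    ℤΣ.sum (λ c → if does (c ≟ b) then classMatrix (class l) c else + 0)
      ≡⟨ ℤΣ.sum-cong-≗ (λ c → cong (λ t → if t then classMatrix (class l) c else + 0)
           (does-⇔ (mk⇔ sym sym) (c ≟ b) (b ≟ c))) ⟩
    ℤΣ.sum (λ c → if does (b ≟ c) then classMatrix (class l) c else + 0)
      ≡⟨ sum-δ b (classMatrix (class l)) ⟩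
    classMatrix (class l) b
      ≡⟨ classMatrix≡quotientMatrix (class l) b ⟩
    quotientMatrix (suc m₁) (suc m₂) k (class l) b
      ≡⟨ cong (λ c → quotientMatrix (suc m₁) (suc m₂) k c b) (class-label i) ⟨
    quotientMatrix (suc m₁) (suc m₂) k (block (suc m₁) (suc m₂) k i) b
      ∎
    where
    open ≡-Reasoning
    l = label i
    classMatrix = weightedMatrix classShift classSign quotientPoint

    δ : ℤ → ℤ
    δ z = if does (class l ≟ b) then z else + 0

  -- The number of merges is the number of vertices, `size + 1 + r * size`, less the number of
  -- labels, `size + 2`.
  multiplicity₁ : totalSurplus ≡ r * (suc m₁ + suc m₂ ∸ 1) ∸ 1
  multiplicity₁ = ℕ.+-cancelʳ-≡ (suc (suc size)) _ _ (begin
    totalSurplus + suc (suc size)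
      ≡⟨ cong (λ z → totalSurplus + z) (List.length-tabulate labelPoint) ⟨
    totalSurplus + length (tabulate labelPoint)
      ≡⟨ V→L.length-⟶ vertices⟶labels ⟨
    length (tabulate vertexPoint)
      ≡⟨ List.length-tabulate vertexPoint ⟩
    suc m₁ + suc m₂ + size * r
      ≡⟨ cong₂ _+_ (cong suc (ℕ.+-suc m₁ m₂)) (ℕ.*-comm size r) ⟩
    suc size + r * size
      ≡⟨ ℕ.+-comm (suc size) (r * size) ⟩
    r * size + suc size
      -- Both `r` and `size` are successors, so `r * size` is positive and the truncated subtraction
      -- is exact.
      ≡⟨ ℕ.+-suc (r * size ∸ 1) (suc size) ⟨
    (r * size ∸ 1) + suc (suc size)
      ≡⟨ cong (λ e → (r * e ∸ 1) + suc (suc size)) (ℕ.+-suc m₁ m₂) ⟨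
    (r * (suc m₁ + suc m₂ ∸ 1) ∸ 1) + suc (suc size)
      ∎)
    where open ≡-Reasoning

  multiplicity₂ : p₁ + p₂ ≡ suc m₁ + suc m₂ ∸ 4
  multiplicity₂ = sym (cong (_∸ 2) (trans (ℕ.+-suc p₁ (suc p₂)) (cong suc (ℕ.+-suc p₁ p₂))))

-- Factorisation of the characteristic polynomial

module _ {c ℓ₁ ℓ₂} (K : HeytingField c ℓ₁ ℓ₂) (p₁ p₂ κ : ℕ) where
  open Quotients p₁ p₂ κ
  open DoubleHyperstar (suc p₁) (suc p₂) (suc κ)
  open CharPoly K
  open Spectral K using (charPoly; fromℤ)
  private
    commutativeRing = HeytingCommutativeRing.commutativeRing (HeytingField.heytingCommutativeRing K)
    n₁ = 2 + p₁
    n₂ = 2 + p₂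
    k  = 3 + κ
  open CommutativeRing commutativeRing using (_≈_; _-_; setoid; *-congˡ)
    renaming (_*_ to _·_)
  open SemiringExp (CommutativeRing.semiring commutativeRing) using (_^_)
  open SetoidReasoning setoid

  -- The characteristic polynomial of the quotient stays as an unfactored term, so the identity
  -- holds whether or not the field contains its roots; any factorisation can be substituted
  -- afterwards.
  charPoly-seidel : ∀ x → charPoly (seidel G) x ≈
    (x - fromℤ (+ 1)) ^ ((k ∸ 2) * (n₁ + n₂ ∸ 1) ∸ 1) ·
    ((x - fromℤ (ℤ.- (+ 2) ℤ.* + k ℤ.+ + 3)) ^ (n₁ + n₂ ∸ 4) · charPoly (quotientMatrix n₁ n₂ k) x)
  charPoly-seidel x = begin
    charPoly (seidel G) x
      ≈⟨ charPoly-cong x (seidel G) (weightedMatrix (const (+ 1)) labelSign vertexPoint) seidel≡weightedMatrix ⟩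
    weightedPoly (const (+ 1)) labelSign x vertexPoint
      ≈⟨ weightedPoly-⟶ (const (+ 1)) labelSign x vertexPoint labelPoint vertices⟶labels ⟩
    (x - fromℤ (+ 1)) ^ totalSurplus · weightedPoly (const (+ 1)) labelSign x labelPoint
      ≈⟨ *-congˡ (charPoly-cong x labelMatrix (weightedMatrix classShift classSign classPoint) labelMatrix≡classMatrix) ⟩
    (x - fromℤ (+ 1)) ^ totalSurplus · weightedPoly classShift classSign x classPoint
      ≈⟨ *-congˡ (weightedPoly-⟶ classShift classSign x classPoint quotientPoint classes⟶quotient) ⟩
    (x - fromℤ (+ 1)) ^ totalSurplus · ((x - fromℤ leafShift) ^ (p₁ + p₂) · weightedPoly classShift classSign x quotientPoint)
      ≈⟨ *-congˡ (*-congˡ (charPoly-cong x (weightedMatrix classShift classSign quotientPoint)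
           (quotientMatrix n₁ n₂ k) classMatrix≡quotientMatrix)) ⟩
    (x - fromℤ (+ 1)) ^ totalSurplus · ((x - fromℤ leafShift) ^ (p₁ + p₂) · charPoly (quotientMatrix n₁ n₂ k) x)
      ≡⟨ cong₂ (λ a b → (x - fromℤ (+ 1)) ^ a · ((x - fromℤ leafShift) ^ b · charPoly (quotientMatrix n₁ n₂ k) x))
           multiplicity₁ multiplicity₂ ⟩
    (x - fromℤ (+ 1)) ^ ((k ∸ 2) * (n₁ + n₂ ∸ 1) ∸ 1) ·
      ((x - fromℤ leafShift) ^ (n₁ + n₂ ∸ 4) · charPoly (quotientMatrix n₁ n₂ k) x)
      ∎

theorem5p2 : ∀ {c ℓ₁ ℓ₂} (K : HeytingField c ℓ₁ ℓ₂) → Spectral.CharacteristicZero K →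
    ∀ (n₁ n₂ k : ℕ) .{{_ : NonZero n₁}} .{{_ : NonZero n₂}} →
    2 ≤ n₁ → 2 ≤ n₂ → 3 ≤ k →
    let open Spectral K in
    IsQuotientMatrix (seidel (doubleHyperstar n₁ n₂ k)) (block n₁ n₂ k) (quotientMatrix n₁ n₂ k)
    ×
    (∀ r₁ r₂ r₃ r₄ r₅ →
    IsSpectrum (quotientMatrix n₁ n₂ k)
    ((r₁ , 1) ∷ (r₂ , 1) ∷ (r₃ , 1) ∷ (r₄ , 1) ∷ (r₅ , 1) ∷ []) →
    IsSpectrum (seidel (doubleHyperstar n₁ n₂ k))
    ( (fromℤ (+ 1) , (k ∸ 2) * (n₁ + n₂ ∸ 1) ∸ 1)
    ∷ (fromℤ (ℤ.- (+ 2) ℤ.* + k ℤ.+ + 3) , n₁ + n₂ ∸ 4)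
    ∷ (r₁ , 1) ∷ (r₂ , 1) ∷ (r₃ , 1) ∷ (r₄ , 1) ∷ (r₅ , 1) ∷ []))
theorem5p2 K _ (suc (suc p₁)) (suc (suc p₂)) (suc (suc (suc κ))) (s≤s (s≤s z≤n)) (s≤s (s≤s z≤n)) (s≤s (s≤s (s≤s z≤n))) =
  Quotients.seidel-quotient p₁ p₂ κ ,
  λ r₁ r₂ r₃ r₄ r₅ spectrum-Q x → R.trans (charPoly-seidel K p₁ p₂ κ x) (R.*-congˡ (R.*-congˡ (spectrum-Q x)))
  where module R = CommutativeRing (HeytingCommutativeRing.commutativeRing (HeytingField.heytingCommutativeRing K))
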